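{- Let $X/\mathbf{Q}$ be a curve with a triple $(\mathcal{Q},W^0,W^{\infty})$ having good reduction at a prime $p$ (all as in the context). Let $e$ and $N$ be positive integers and let $P,Q \in X(\mathbf{Q}_p(p^{1/e}))$ be two points in the same residue disk, accurate to precision $N$. Let $P'$ be the very bad point of this residue disk if the disk is bad, and $P'=P$ otherwise; let $t$ be a local coordinate at $P'$ (in the integral sense defined in the context). Suppose that $\omega = g(t)\,dt$ is a differential of the second kind with $$g(t) = a_{ -k} t^{ -k} + a_{ -k+1} t^{ -k+1} + \cdots \in \mathbf{Z}_p[[t]][t^{ -1}]$$ for some positive integer $k$. If $g$ is accurate to $p$-adic precision $N$ and truncated modulo $t^l$, then the tiny integral $\int_P^Q \omega$, computed by integrating the truncated Laurent series termwise and evaluating at $t(Q)$ and $t(P)$, is correct to precision $\min\{\nu_1,\nu_2,\nu_3\}$, where \begin{align*} \nu_1 &= 1/e + \min_{i \geq l} \{ i/e-\lfloor \log_p(i+1) \rfloor \}, \\ \nu_2 &= N + \min_{0 \leq i \leq l-1} \{ i/e- \lfloor \log_p(i+1) \rfloor \}, \\ \nu_3 &= N - k\max \{ \mathrm{ord}_{p}(t(P)),\mathrm{ord}_p(t(Q))\}-\lfloor \log_p(k-1) \rfloor, \end{align*} with the convention $\nu_3=+\infty$ if $k=1$.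
   Context: Curve. $X$ is a nonsingular projective geometrically irreducible curve of genus $g$ over $\mathbf{Q}$ given by a (possibly singular) plane model $\mathcal{Q}(x,y)=0$, with $\mathcal{Q} \in \mathbf{Z}[x,y]$ irreducible and monic in $y$; $d_x$ is the degree of $\mathcal{Q}$ in $y$ (the degree of $x: X\to\mathbf{P}^1$). $\Delta(x)\in\mathbf{Z}[x]$ is the discriminant of $\mathcal{Q}$ with respect to $y$ and $r=\Delta/\gcd(\Delta,d\Delta/dx)$. $W^0\in \mathrm{GL}_{d_x}(\mathbf{Q}[x,1/r])$ and $W^\infty\in \mathrm{GL}_{d_x}(\mathbf{Q}[x,1/x,1/r])$ are matrices such that, with $b^0_j=\sum_{i=0}^{d_x-1}W^0_{i+1,j+1}y^i$ and $b^\infty_j=\sum_{i=0}^{d_x-1}W^\infty_{i+1,j+1}y^i$ ($0\le j\le d_x-1$), $[b^0_j]_j$ is an integral basis of the function field $\mathbf{Q}(X)$ over $\mathbf{Q}[x]$ and $[b^\infty_j]_j$ is one over $\mathbf{Q}[1/x]$. Good reduction of $(\mathcal{Q},W^0,W^\infty)$ at $p$ means: (1) the discriminant of $r$ is in $\mathbf{Z}_p^\times$; (2) the reductions mod $p$ of $[b^0_j]$ and $[b^\infty_j]$ are integral bases of $\mathrm{Frac}(\mathbf{F}_p[x,y]/(\mathcal{Q}))$ over $\mathbf{F}_p[x]$ and $\mathbf{F}_p[1/x]$ respectively; (3) $W^0\in\mathrm{GL}_{d_x}(\mathbf{Z}_p[x,1/r])$, $W^\infty\in\mathrm{GL}_{d_x}(\mathbf{Z}_p[x,1/x,1/r])$;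 (4) with $\mathcal{R}^0=\sum_j\mathbf{Z}_p[x]b^0_j$ and $\mathcal{R}^\infty=\sum_j\mathbf{Z}_p[1/x]b^\infty_j$, the discriminants of the finite $\mathbf{Z}_p$-algebras $(\mathcal{R}^0/(r(x)))_{\mathrm{red}}$ and $(\mathcal{R}^\infty/(1/x))_{\mathrm{red}}$ are in $\mathbf{Z}_p^\times$. Gluing $\mathrm{Spec}\,\mathcal{R}^0$ and $\mathrm{Spec}\,\mathcal{R}^\infty$ along the loci where $x$ is invertible gives a smooth curve $\mathcal{X}/\mathbf{Z}_p$ with $\mathcal{X}\otimes\mathbf{Q}_p\cong X\otimes\mathbf{Q}_p$. $X^{an}$ is its rigid analytic generic fibre; the fibres of the specialization map from $X^{an}$ to the reduction mod $p$ are the residue disks. A point is very infinite if $x=\infty$, and very bad if it is very infinite or $x$ is a zero of $r$. A residue disk (and any point in it) is bad (resp. infinite) if it contains a very bad (resp. very infinite) point, and good (resp. finite) otherwise. A residue disk contains at most one very bad point. Local coordinate. $t$ is a local coordinate at $P'$ not only on $X$ but on $\mathcal{X}$: its reduction mod $p$ is a local coordinate at the reduction of $P'$ and the residue disk of $P'$ is $|t|<1$. Concretely $t=x-x(P')$ (or $1/x$ if $P'$ is infinite) if the ramification index of $x$ at $P'$ is $1$, and otherwise $t=b^0_i-b^0_i(P')$ (with $b^\infty$ in place of $b^0$ if $P'$ is infinite) for a suitable $i$. Precision. Precision always means absolute $p$-adic precision, i.e. a computed value is correct (accurate) to precision $\nu$ if the $p$-adic valuation $\mathrm{ord}_p$ (extended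 to finite extensions of $\mathbf{Q}_p$, $\mathrm{ord}_p(p)=1$) of its difference with the true value is at least $\nu$. A point is represented by its $x$-value and the values of the $b^0_j$ (respectively $1/x$ and the $b^\infty_j$ for an infinite point); it is accurate to precision $N$ if these values are, so that $t(P)$, $t(Q)$ are known to precision $N$. That $g$ is accurate to precision $N$ means each coefficient $a_i$ is known to precision $N$. Inverting a computed value presupposes that it is nonzero to the given precision. Tiny integral. A Coleman integral between two points of the same residue disk; here $\int_P^Q\omega=\sum_{i\ge -k,\ i\ne -1}\frac{a_i}{i+1}\left(t(Q)^{i+1}-t(P)^{i+1}\right)$, where $a_{ -1}=0$ because $\omega$ is of the second kind. The computed value is the same sum restricted to $i\le l-1$, evaluated with the approximate data. -}

module Defs where

open import Algebra.Bundles using (CommutativeRing; CommutativeSemiring; RawRing)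
open import Algebra.Structures using (IsCommutativeRing)
open import Algebra.Definitions.RawMagma using (_,_)
import Algebra.Definitions.RawSemiring as RawSemiringDefs
open import Algebra.Morphism.Structures using (module RingMorphisms)
import Algebra.Morphism.RingMonomorphism as RingMono
import Algebra.Properties.Ring as RingProps
import Algebra.Properties.Semiring.Exp as SemiringExp
import Algebra.Properties.Semiring.Mult as SemiringMult
import Algebra.Solver.Ring.NaturalCoefficients.Default as SemiringSolver
open import Data.Bool.Base using (if_then_else_)
open import Data.Fin.Base using (Fin; zero; suc; toℕ; opposite; punchIn; splitAt)
open import Data.Integer.Base as ℤ using (ℤ; +_; -[1+_]; _⊖_)
import Data.Integer.Properties as ℤProps
open import Data.List.Base using (List; []; _∷_; map; replicate; _++_; foldr)
open import Data.Nat.Base as ℕ using (ℕ; zero; suc; NonZero)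
open import Data.Product.Base using (Σ; ∃; _×_; _,_; proj₁; proj₂; Σ-syntax; ∃-syntax)
open import Data.Rational.Base as ℚ using (ℚ)
import Data.Rational.Properties as ℚProps
open import Data.Sum.Base using (_⊎_; inj₁; inj₂; [_,_]′)
open import Function.Base using (_∘_; id)
open import Function.Bundles using (_⇔_)
open import Level using (0ℓ)
open import Relation.Binary.Core using (Rel)
open import Relation.Binary.PropositionalEquality as ≡ using (_≡_)
open import Relation.Binary.Structures using (IsEquivalence)
import Relation.Binary.Reasoning.Setoid as SetoidReasoning
open import Relation.Nullary.Construct.Add.Supremum using (_⁺; ⊤⁺; [_])
open import Relation.Nullary.Negation using (¬_)

------------------------------------------------------------------------
-- Commutative rings

CR : Set₁
CR = CommutativeRing 0ℓ 0ℓ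

⟨_⟩ : CR → Set
⟨ R ⟩ = CommutativeRing.Carrier R

module Ring (R : CR) where
  open CommutativeRing R public hiding (zero)
  open RawSemiringDefs (CommutativeSemiring.rawSemiring commutativeSemiring) public
    using (_∣_; _^_; sum; Irreducible) renaming (_×_ to _⋆_)

  fromℕ : ℕ → Carrier
  fromℕ n = n ⋆ 1#

  fromℤ : ℤ → Carrier
  fromℤ (+ n)    = fromℕ n
  fromℤ -[1+ n ] = - fromℕ (suc n)

  Unit : Carrier → Set
  Unit a = a ∣ 1#

  Regular : Carrier → Set
  Regular s = ∀ z → z * s ≈ 0# → z ≈ 0#

  IsGCD : Carrier → Carrier → Carrier → Set
  IsGCD a b g = g ∣ a × g ∣ b × (∀ {c} → c ∣ a → c ∣ b → c ∣ g)

  Matrix : ℕ → Set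
  Matrix n = Fin n → Fin n → Carrier

  det : ∀ n → Matrix n → Carrier
  det zero    M = 1#
  det (suc n) M =
    sum (λ j → (- 1#) ^ toℕ j * M zero j * det n (λ i k → M (suc i) (punchIn j k)))

  δ : ∀ {n} → Matrix n
  δ zero    zero    = 1#
  δ zero    (suc j) = 0#
  δ (suc i) zero    = 0#
  δ (suc i) (suc j) = δ i j

  _·_ : ∀ {n} → Matrix n → Matrix n → Matrix n
  (M · N) i k = sum (λ j → M i j * N j k)

  MutuallyInverse : ∀ {n} → Matrix n → Matrix n → Set
  MutuallyInverse M N = (∀ i j → (M · N) i j ≈ δ i j) × (∀ i j → (N · M) i j ≈ δ i j)

module Coarsen (R : CR) (_∼_ : Rel ⟨ R ⟩ 0ℓ) (equiv : IsEquivalence _∼_) where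
  open CommutativeRing R

  abstract
    isCommutativeRing-∼ : (∀ {a b} → a ≈ b → a ∼ b) →
                          (∀ {a b c d} → a ∼ b → c ∼ d → (a + c) ∼ (b + d)) →
                          (∀ {a b c d} → a ∼ b → c ∼ d → (a * c) ∼ (b * d)) →
                          (∀ {a b} → a ∼ b → (- a) ∼ (- b)) →
                          IsCommutativeRing _∼_ _+_ _*_ -_ 0# 1#
    isCommutativeRing-∼ ≈⇒∼ +-cong′ *-cong′ -‿cong′ = record
      { isRing = record
        { +-isAbelianGroup = record
          { isGroup = record
            { isMonoid = record
              { isSemigroup = record
                { isMagma = record { isEquivalence = equiv ; ∙-cong = +-cong′ }
                ; assoc = λ a b c → ≈⇒∼ (+-assoc a b c) }
              ; identity = (λ a → ≈⇒∼ (+-identityˡ a)) , (λ a → ≈⇒∼ (+-identityʳ a)) }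
            ; inverse = (λ a → ≈⇒∼ (-‿inverseˡ a)) , (λ a → ≈⇒∼ (-‿inverseʳ a))
            ; ⁻¹-cong = -‿cong′ }
          ; comm = λ a b → ≈⇒∼ (+-comm a b) }
        ; *-cong = *-cong′
        ; *-assoc = λ a b c → ≈⇒∼ (*-assoc a b c)
        ; *-identity = (λ a → ≈⇒∼ (*-identityˡ a)) , (λ a → ≈⇒∼ (*-identityʳ a))
        ; distrib = (λ a b c → ≈⇒∼ (distribˡ a b c)) , (λ a b c → ≈⇒∼ (distribʳ a b c)) }
      ; *-comm = λ a b → ≈⇒∼ (*-comm a b) }

------------------------------------------------------------------------
-- R / (f)

record Congruent (R : CR) (f a b : ⟨ R ⟩) : Set where
  constructor congruent
  open Ring R
  field
    divides : f ∣ a - b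

_/⟨_⟩ : (R : CR) → ⟨ R ⟩ → CR
R /⟨ f ⟩ = record
  { _≈_ = Congruent R f ; _+_ = R._+_ ; _*_ = R._*_ ; -_ = R.-_ ; 0# = R.0# ; 1# = R.1#
  ; isCommutativeRing = Coarsen.isCommutativeRing-∼ R _∼_
      (record { refl = ≈⇒∼ R.refl ; sym = ∼-sym ; trans = ∼-trans })
      ≈⇒∼ +-cong′ *-cong′ neg-cong′ }
  where
  module R = CommutativeRing R
  open R
  open RingProps ring
  open SemiringSolver commutativeSemiring
  open SetoidReasoning setoid
  _∼_ : Rel Carrier 0ℓ
  _∼_ = Congruent R f
  ≈⇒∼ : ∀ {a b} → a ≈ b → a ∼ b
  ≈⇒∼ {a} {b} e = congruent (0# , trans (zeroˡ f) (sym (trans (+-congʳ e) (-‿inverseʳ b))))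
  ∼-sym : ∀ {a b} → a ∼ b → b ∼ a
  ∼-sym {a} {b} (congruent (q , e)) = congruent (- q , (begin
    - q * f     ≈⟨ -‿distribˡ-* q f ⟨
    - (q * f)   ≈⟨ -‿cong e ⟩
    - (a - b)   ≈⟨ -‿+-comm a (- b) ⟨
    - a - - b   ≈⟨ +-congˡ (-‿involutive b) ⟩
    - a + b     ≈⟨ +-comm (- a) b ⟩
    b - a       ∎))
  ∼-trans : ∀ {a b c} → a ∼ b → b ∼ c → a ∼ c
  ∼-trans {a} {b} {c} (congruent (q , e)) (congruent (q′ , e′)) = congruent (q + q′ , (begin
    (q + q′) * f            ≈⟨ distribʳ f q q′ ⟩
    q * f + q′ * f          ≈⟨ +-cong e e′ ⟩
    (a - b) + (b - c)       ≈⟨ solve 4 (λ a b b′ c → (a :+ b′) :+ (b :+ c) := (a :+ c) :+ (b :+ b′)) refl a b (- b) (- c) ⟩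
    (a - c) + (b - b)       ≈⟨ +-congˡ (-‿inverseʳ b) ⟩
    (a - c) + 0#            ≈⟨ +-identityʳ (a - c) ⟩
    a - c                   ∎))
  +-cong′ : ∀ {a b c d} → a ∼ b → c ∼ d → (a + c) ∼ (b + d)
  +-cong′ {a} {b} {c} {d} (congruent (q , e)) (congruent (q′ , e′)) = congruent (q + q′ , (begin
    (q + q′) * f            ≈⟨ distribʳ f q q′ ⟩
    q * f + q′ * f          ≈⟨ +-cong e e′ ⟩
    (a - b) + (c - d)       ≈⟨ solve 4 (λ a b c d → (a :+ b) :+ (c :+ d) := (a :+ c) :+ (b :+ d)) refl a (- b) c (- d) ⟩
    (a + c) + (- b - d)     ≈⟨ +-congˡ (-‿+-comm b d) ⟩
    (a + c) - (b + d)       ∎))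
  *-cong′ : ∀ {a b c d} → a ∼ b → c ∼ d → (a * c) ∼ (b * d)
  *-cong′ {a} {b} {c} {d} (congruent (q , e)) (congruent (q′ , e′)) = congruent (q * c + b * q′ , (begin
    (q * c + b * q′) * f          ≈⟨ solve 5 (λ q c b q′ f → (q :* c :+ b :* q′) :* f := (q :* f) :* c :+ b :* (q′ :* f)) refl q c b q′ f ⟩
    (q * f) * c + b * (q′ * f)    ≈⟨ +-cong (*-congʳ e) (*-congˡ e′) ⟩
    (a - b) * c + b * (c - d)     ≈⟨ solve 5 (λ a nb c b nd → (a :+ nb) :* c :+ b :* (c :+ nd) := (a :* c :+ b :* nd) :+ (b :+ nb) :* c) refl a (- b) c b (- d) ⟩
    (a * c + b * - d) + (b - b) * c ≈⟨ +-congˡ (trans (*-congʳ (-‿inverseʳ b)) (zeroˡ c)) ⟩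
    (a * c + b * - d) + 0#        ≈⟨ +-identityʳ _ ⟩
    a * c + b * - d               ≈⟨ +-congˡ (-‿distribʳ-* b d) ⟨
    a * c - b * d                 ∎))
  neg-cong′ : ∀ {a b} → a ∼ b → (- a) ∼ (- b)
  neg-cong′ {a} {b} (congruent (q , e)) = congruent (- q , (begin
    - q * f      ≈⟨ -‿distribˡ-* q f ⟨
    - (q * f)    ≈⟨ -‿cong e ⟩
    - (a - b)    ≈⟨ -‿+-comm a (- b) ⟨
    - a - - b    ∎))

------------------------------------------------------------------------
-- Localisation

-- σ enumerates the multiplicative set, so that a fraction is a numerator
-- together with an index of its denominator.
record MultiplicativeSet (R : CR) : Set₁ where
  open CommutativeRing R
  infixl 7 _∙_
  field
    Index : Set
    σ     : Index → Carrier
    ε     : Index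
    _∙_   : Index → Index → Index
    σ-ε   : σ ε ≈ 1#
    σ-∙   : ∀ i j → σ (i ∙ j) ≈ σ i * σ j

module Localisation (R : CR) (S : MultiplicativeSet R) where
  open CommutativeRing R
  open MultiplicativeSet S
  open RingProps ring
  open SemiringSolver commutativeSemiring
  open SetoidReasoning setoid

  Fraction : Set
  Fraction = Carrier × Index

  record _≃_ (x y : Fraction) : Set where
    constructor _,_
    field
      witness  : Index
      equality : let (a , i) = x ; (b , j) = y in
                 σ witness * (a * σ j) ≈ σ witness * (b * σ i)

  _⊕_ _⊗_ : Fraction → Fraction → Fraction
  (a , i) ⊕ (b , j) = a * σ j + b * σ i , i ∙ j
  (a , i) ⊗ (b , j) = a * b , i ∙ j

  private
    by : ∀ {a i b j} → a * σ j ≈ b * σ i → (a , i) ≃ (b , j)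
    by e = ε , *-congˡ e

    ≃-trans : ∀ {x y z} → x ≃ y → y ≃ z → x ≃ z
    ≃-trans {a , i} {b , j} {c , l} (k , e) (m , e′) = k ∙ m ∙ j , (begin
      σ (k ∙ m ∙ j) * (a * σ l)       ≈⟨ *-congʳ σ₃ ⟩
      σ k * σ m * σ j * (a * σ l)     ≈⟨ solve 5 (λ k m j a l → k :* m :* j :* (a :* l) := (k :* (a :* j)) :* (m :* l)) refl (σ k) (σ m) (σ j) a (σ l) ⟩
      (σ k * (a * σ j)) * (σ m * σ l) ≈⟨ *-congʳ e ⟩
      (σ k * (b * σ i)) * (σ m * σ l) ≈⟨ solve 5 (λ k m i b l → (k :* (b :* i)) :* (m :* l) := (m :* (b :* l)) :* (k :* i)) refl (σ k) (σ m) (σ i) b (σ l) ⟩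
      (σ m * (b * σ l)) * (σ k * σ i) ≈⟨ *-congʳ e′ ⟩
      (σ m * (c * σ j)) * (σ k * σ i) ≈⟨ solve 5 (λ k m i c j → (m :* (c :* j)) :* (k :* i) := k :* m :* j :* (c :* i)) refl (σ k) (σ m) (σ i) c (σ j) ⟩
      σ k * σ m * σ j * (c * σ i)     ≈⟨ *-congʳ σ₃ ⟨
      σ (k ∙ m ∙ j) * (c * σ i)       ∎)
      where
      σ₃ : σ (k ∙ m ∙ j) ≈ σ k * σ m * σ j
      σ₃ = trans (σ-∙ (k ∙ m) j) (*-congʳ (σ-∙ k m))

    ⊕-cong : ∀ {x y z w} → x ≃ y → z ≃ w → (x ⊕ z) ≃ (y ⊕ w)
    ⊕-cong {a , i} {b , j} {c , l} {d , n} (k , e) (m , e′) = k ∙ m , (begin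
      σ (k ∙ m) * ((a * σ l + c * σ i) * σ (j ∙ n))
        ≈⟨ *-cong (σ-∙ k m) (*-congˡ (σ-∙ j n)) ⟩
      (σ k * σ m) * ((a * σ l + c * σ i) * (σ j * σ n))
        ≈⟨ solve 8 (λ k m a l c i j n → (k :* m) :* ((a :* l :+ c :* i) :* (j :* n)) := (k :* (a :* j)) :* (m :* l :* n) :+ (m :* (c :* n)) :* (k :* i :* j)) refl (σ k) (σ m) a (σ l) c (σ i) (σ j) (σ n) ⟩
      (σ k * (a * σ j)) * (σ m * σ l * σ n) + (σ m * (c * σ n)) * (σ k * σ i * σ j)
        ≈⟨ +-cong (*-congʳ e) (*-congʳ e′) ⟩
      (σ k * (b * σ i)) * (σ m * σ l * σ n) + (σ m * (d * σ l)) * (σ k * σ i * σ j)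
        ≈⟨ solve 8 (λ k m b l d i j n → (k :* (b :* i)) :* (m :* l :* n) :+ (m :* (d :* l)) :* (k :* i :* j) := (k :* m) :* ((b :* n :+ d :* j) :* (i :* l))) refl (σ k) (σ m) b (σ l) d (σ i) (σ j) (σ n) ⟩
      (σ k * σ m) * ((b * σ n + d * σ j) * (σ i * σ l))
        ≈⟨ *-cong (σ-∙ k m) (*-congˡ (σ-∙ i l)) ⟨
      σ (k ∙ m) * ((b * σ n + d * σ j) * σ (i ∙ l)) ∎)

    ⊗-cong : ∀ {x y z w} → x ≃ y → z ≃ w → (x ⊗ z) ≃ (y ⊗ w)
    ⊗-cong {a , i} {b , j} {c , l} {d , n} (k , e) (m , e′) = k ∙ m , (begin
      σ (k ∙ m) * ((a * c) * σ (j ∙ n))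
        ≈⟨ *-cong (σ-∙ k m) (*-congˡ (σ-∙ j n)) ⟩
      (σ k * σ m) * ((a * c) * (σ j * σ n))
        ≈⟨ solve 6 (λ k m a c j n → (k :* m) :* ((a :* c) :* (j :* n)) := (k :* (a :* j)) :* (m :* (c :* n))) refl (σ k) (σ m) a c (σ j) (σ n) ⟩
      (σ k * (a * σ j)) * (σ m * (c * σ n))
        ≈⟨ *-cong e e′ ⟩
      (σ k * (b * σ i)) * (σ m * (d * σ l))
        ≈⟨ solve 6 (λ k m b d i l → (k :* (b :* i)) :* (m :* (d :* l)) := (k :* m) :* ((b :* d) :* (i :* l))) refl (σ k) (σ m) b d (σ i) (σ l) ⟩
      (σ k * σ m) * ((b * d) * (σ i * σ l))
        ≈⟨ *-cong (σ-∙ k m) (*-congˡ (σ-∙ i l)) ⟨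
      σ (k ∙ m) * ((b * d) * σ (i ∙ l)) ∎)

    neg-cong : ∀ {a i b j} → (a , i) ≃ (b , j) → (- a , i) ≃ (- b , j)
    neg-cong {a} {i} {b} {j} (k , e) = k , (begin
      σ k * (- a * σ j)   ≈⟨ *-congˡ (-‿distribˡ-* a (σ j)) ⟨
      σ k * - (a * σ j)   ≈⟨ -‿distribʳ-* (σ k) (a * σ j) ⟨
      - (σ k * (a * σ j)) ≈⟨ -‿cong e ⟩
      - (σ k * (b * σ i)) ≈⟨ -‿distribʳ-* (σ k) (b * σ i) ⟩
      σ k * - (b * σ i)   ≈⟨ *-congˡ (-‿distribˡ-* b (σ i)) ⟩
      σ k * (- b * σ i)   ∎)

    ⊕-comm : ∀ x y → (x ⊕ y) ≃ (y ⊕ x)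
    ⊕-comm (a , i) (b , j) = by (*-cong (+-comm _ _)
      (trans (σ-∙ j i) (trans (*-comm _ _) (sym (σ-∙ i j)))))

    ⊕-assoc : ∀ x y z → ((x ⊕ y) ⊕ z) ≃ (x ⊕ (y ⊕ z))
    ⊕-assoc (a , i) (b , j) (c , l) = by (begin
      ((a * σ j + b * σ i) * σ l + c * σ (i ∙ j)) * σ (i ∙ (j ∙ l))
        ≈⟨ *-cong (+-congˡ (*-congˡ (σ-∙ i j))) (trans (σ-∙ i (j ∙ l)) (*-congˡ (σ-∙ j l))) ⟩
      ((a * σ j + b * σ i) * σ l + c * (σ i * σ j)) * (σ i * (σ j * σ l))
        ≈⟨ solve 6 (λ a j b i l c → ((a :* j :+ b :* i) :* l :+ c :* (i :* j)) :* (i :* (j :* l)) := (a :* (j :* l) :+ (b :* l :+ c :* j) :* i) :* ((i :* j) :* l)) refl a (σ j) b (σ i) (σ l) c ⟩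
      (a * (σ j * σ l) + (b * σ l + c * σ j) * σ i) * ((σ i * σ j) * σ l)
        ≈⟨ *-cong (+-congʳ (*-congˡ (σ-∙ j l))) (trans (σ-∙ (i ∙ j) l) (*-congʳ (σ-∙ i j))) ⟨
      (a * σ (j ∙ l) + (b * σ l + c * σ j) * σ i) * σ (i ∙ j ∙ l) ∎)

    ⊕-identityˡ : ∀ x → ((0# , ε) ⊕ x) ≃ x
    ⊕-identityˡ (a , i) = by (begin
      (0# * σ i + a * σ ε) * σ i ≈⟨ *-congʳ (trans (+-congʳ (zeroˡ _)) (+-identityˡ _)) ⟩
      a * σ ε * σ i              ≈⟨ *-assoc a _ _ ⟩
      a * (σ ε * σ i)            ≈⟨ *-congˡ (σ-∙ ε i) ⟨
      a * σ (ε ∙ i)              ∎)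

    ⊕-inverseˡ : ∀ a i → ((- a , i) ⊕ (a , i)) ≃ (0# , ε)
    ⊕-inverseˡ a i = by (begin
      (- a * σ i + a * σ i) * σ ε ≈⟨ *-congʳ (distribʳ (σ i) (- a) a) ⟨
      ((- a + a) * σ i) * σ ε     ≈⟨ *-congʳ (trans (*-congʳ (-‿inverseˡ a)) (zeroˡ _)) ⟩
      0# * σ ε                    ≈⟨ zeroˡ _ ⟩
      0#                          ≈⟨ zeroˡ _ ⟨
      0# * σ (i ∙ i)              ∎)

    ⊗-comm : ∀ x y → (x ⊗ y) ≃ (y ⊗ x)
    ⊗-comm (a , i) (b , j) = by (*-cong (*-comm a b)
      (trans (σ-∙ j i) (trans (*-comm _ _) (sym (σ-∙ i j)))))

    ⊗-assoc : ∀ x y z → ((x ⊗ y) ⊗ z) ≃ (x ⊗ (y ⊗ z))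
    ⊗-assoc (a , i) (b , j) (c , l) = by (begin
      a * b * c * σ (i ∙ (j ∙ l))     ≈⟨ *-cong (*-assoc a b c) (trans (σ-∙ i (j ∙ l)) (*-congˡ (σ-∙ j l))) ⟩
      a * (b * c) * (σ i * (σ j * σ l)) ≈⟨ *-congˡ (*-assoc (σ i) (σ j) (σ l)) ⟨
      a * (b * c) * (σ i * σ j * σ l) ≈⟨ *-congˡ (trans (σ-∙ (i ∙ j) l) (*-congʳ (σ-∙ i j))) ⟨
      a * (b * c) * σ (i ∙ j ∙ l)     ∎)

    ⊗-identityˡ : ∀ x → ((1# , ε) ⊗ x) ≃ x
    ⊗-identityˡ (a , i) = by (begin
      1# * a * σ i      ≈⟨ *-congʳ (*-identityˡ a) ⟩
      a * σ i           ≈⟨ *-congˡ (trans (*-congʳ σ-ε) (*-identityˡ (σ i))) ⟨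
      a * (σ ε * σ i)   ≈⟨ *-congˡ (σ-∙ ε i) ⟨
      a * σ (ε ∙ i)     ∎)

    ⊗-distribˡ : ∀ x y z → (x ⊗ (y ⊕ z)) ≃ ((x ⊗ y) ⊕ (x ⊗ z))
    ⊗-distribˡ (a , i) (b , j) (c , l) = by (begin
      a * (b * σ l + c * σ j) * σ ((i ∙ j) ∙ (i ∙ l))
        ≈⟨ *-congˡ (trans (σ-∙ _ _) (*-cong (σ-∙ i j) (σ-∙ i l))) ⟩
      a * (b * σ l + c * σ j) * ((σ i * σ j) * (σ i * σ l))
        ≈⟨ solve 6 (λ a b c i j l → a :* (b :* l :+ c :* j) :* ((i :* j) :* (i :* l)) := (a :* b :* (i :* l) :+ a :* c :* (i :* j)) :* (i :* (j :* l))) refl a b c (σ i) (σ j) (σ l) ⟩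
      (a * b * (σ i * σ l) + a * c * (σ i * σ j)) * (σ i * (σ j * σ l))
        ≈⟨ *-cong (+-cong (*-congˡ (σ-∙ i l)) (*-congˡ (σ-∙ i j))) (trans (σ-∙ i (j ∙ l)) (*-congˡ (σ-∙ j l))) ⟨
      (a * b * σ (i ∙ l) + a * c * σ (i ∙ j)) * σ (i ∙ (j ∙ l)) ∎)

  abstract
    localisation-isCommutativeRing : IsCommutativeRing _≃_ _⊕_ _⊗_ (λ (a , i) → - a , i) (0# , ε) (1# , ε)
    localisation-isCommutativeRing = record
      { isRing = record
        { +-isAbelianGroup = record
          { isGroup = record
            { isMonoid = record
              { isSemigroup = record
                { isMagma = record
                  { isEquivalence = record
                    { refl = by refl ; sym = λ (k , e) → k , sym e ; trans = ≃-trans }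
                  ; ∙-cong = ⊕-cong }
                ; assoc = ⊕-assoc }
              ; identity = ⊕-identityˡ , λ x → ≃-trans (⊕-comm x _) (⊕-identityˡ x) }
            ; inverse = (λ (a , i) → ⊕-inverseˡ a i)
                      , (λ (a , i) → ≃-trans (⊕-comm (a , i) (- a , i)) (⊕-inverseˡ a i))
            ; ⁻¹-cong = neg-cong }
          ; comm = ⊕-comm }
        ; *-cong = ⊗-cong
        ; *-assoc = ⊗-assoc
        ; *-identity = ⊗-identityˡ , λ x → ≃-trans (⊗-comm x _) (⊗-identityˡ x)
        ; distrib = ⊗-distribˡ
                  , λ x y z → ≃-trans (⊗-comm (y ⊕ z) x)
                      (≃-trans (⊗-distribˡ x y z) (⊕-cong (⊗-comm x y) (⊗-comm x z))) }
      ; *-comm = ⊗-comm }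

  localisation : CR
  localisation = record
    { Carrier = Fraction ; _≈_ = _≃_ ; _+_ = _⊕_ ; _*_ = _⊗_
    ; -_ = λ (a , i) → - a , i ; 0# = 0# , ε ; 1# = 1# , ε
    ; isCommutativeRing = localisation-isCommutativeRing }

module _ (R : CR) where
  open Ring R

  private
    abstract
      1-regular : Regular 1#
      1-regular z e = trans (sym (*-identityʳ z)) e

      *-regular : ∀ {s t} → Regular s → Regular t → Regular (s * t)
      *-regular {s} {t} reg reg′ z e = reg z (reg′ (z * s) (trans (*-assoc z s t) e))

  powersOf : Carrier → MultiplicativeSet R
  powersOf s = record
    { Index = ℕ ; σ = s ^_ ; ε = 0 ; _∙_ = ℕ._+_
    ; σ-ε = refl ; σ-∙ = SemiringExp.^-homo-* semiring s }

  -- The index n stands for the denominator n + 1.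
  positiveIntegers : MultiplicativeSet R
  positiveIntegers = record
    { Index = ℕ ; σ = λ n → fromℕ (suc n) ; ε = 0 ; _∙_ = λ m n → n ℕ.+ m ℕ.* suc n
    ; σ-ε = +-identityʳ 1# ; σ-∙ = λ m n → SemiringMult.×1-homo-* semiring (suc m) (suc n) }

  regularElements : MultiplicativeSet R
  regularElements = record
    { Index = Σ Carrier Regular ; σ = proj₁ ; ε = 1# , 1-regular
    ; _∙_ = λ (s , reg) (t , reg′) → s * t , *-regular reg reg′
    ; σ-ε = refl ; σ-∙ = λ _ _ → refl }

_[1/_] : (R : CR) → ⟨ R ⟩ → CR
R [1/ s ] = Localisation.localisation R (powersOf R s)

_⊗ℚ : CR → CR
R ⊗ℚ = Localisation.localisation R (positiveIntegers R)

-- The total ring of fractions, which is the fraction field if R is a domain.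
Frac : CR → CR
Frac R = Localisation.localisation R (regularElements R)

------------------------------------------------------------------------
-- Power series and polynomials

module Series (R : CR) where
  open CommutativeRing R
  open RingProps ring using (-0#≈0#)
  open SemiringSolver commutativeSemiring
  open SetoidReasoning setoid

  -- (f * g)₀ = f₀ g₀  and  (f * g)ₙ₊₁ = f₀ gₙ₊₁ + (((f - f₀) / T) * g)ₙ
  conv : (ℕ → Carrier) → (ℕ → Carrier) → ℕ → Carrier
  conv f g zero    = f 0 * g 0
  conv f g (suc n) = f 0 * g (suc n) + conv (f ∘ suc) g n

  one : ℕ → Carrier
  one zero    = 1#
  one (suc _) = 0#

  conv-cong : ∀ {f f′ g g′} → (∀ n → f n ≈ f′ n) → (∀ n → g n ≈ g′ n) →
              ∀ n → conv f g n ≈ conv f′ g′ n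
  conv-cong e e′ zero    = *-cong (e 0) (e′ 0)
  conv-cong e e′ (suc n) = +-cong (*-cong (e 0) (e′ (suc n))) (conv-cong (e ∘ suc) e′ n)

  conv-zeroˡ : ∀ g n → conv (λ _ → 0#) g n ≈ 0#
  conv-zeroˡ g zero    = zeroˡ _
  conv-zeroˡ g (suc n) = trans (+-cong (zeroˡ _) (conv-zeroˡ g n)) (+-identityˡ 0#)

  conv-scale : ∀ a f g n → conv (λ m → a * f m) g n ≈ a * conv f g n
  conv-scale a f g zero    = *-assoc a _ _
  conv-scale a f g (suc n) =
    trans (+-cong (*-assoc a _ _) (conv-scale a (f ∘ suc) g n)) (sym (distribˡ a _ _))

  private
    conv-distribʳ : ∀ h f g n → conv (λ m → f m + g m) h n ≈ conv f h n + conv g h n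
    conv-distribʳ h f g zero    = distribʳ _ _ _
    conv-distribʳ h f g (suc n) = trans
      (+-cong (distribʳ _ _ _) (conv-distribʳ h (f ∘ suc) (g ∘ suc) n))
      (solve 4 (λ a b c d → (a :+ b) :+ (c :+ d) := (a :+ c) :+ (b :+ d)) refl _ _ _ _)

    conv-unfoldʳ : ∀ f g n → conv f g (suc n) ≈ conv f (g ∘ suc) n + f (suc n) * g 0
    conv-unfoldʳ f g zero    = refl
    conv-unfoldʳ f g (suc n) =
      trans (+-congˡ (conv-unfoldʳ (f ∘ suc) g n)) (sym (+-assoc _ _ _))

    conv-comm : ∀ f g n → conv f g n ≈ conv g f n
    conv-comm f g zero    = *-comm _ _
    conv-comm f g (suc n) = begin
      f 0 * g (suc n) + conv (f ∘ suc) g n ≈⟨ +-cong (*-comm _ _) (conv-comm (f ∘ suc) g n) ⟩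
      g (suc n) * f 0 + conv g (f ∘ suc) n ≈⟨ +-comm _ _ ⟩
      conv g (f ∘ suc) n + g (suc n) * f 0 ≈⟨ conv-unfoldʳ g f n ⟨
      conv g f (suc n)                     ∎

    conv-assoc : ∀ f g h n → conv (conv f g) h n ≈ conv f (conv g h) n
    conv-assoc f g h zero    = *-assoc _ _ _
    conv-assoc f g h (suc n) = begin
      f 0 * g 0 * h (suc n) + conv (λ m → f 0 * g (suc m) + conv (f ∘ suc) g m) h n
        ≈⟨ +-congˡ (conv-distribʳ h (λ m → f 0 * g (suc m)) (conv (f ∘ suc) g) n) ⟩
      f 0 * g 0 * h (suc n) + (conv (λ m → f 0 * g (suc m)) h n + conv (conv (f ∘ suc) g) h n)
        ≈⟨ +-cong (*-assoc _ _ _) (+-cong (conv-scale (f 0) (g ∘ suc) h n) (conv-assoc (f ∘ suc) g h n)) ⟩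
      f 0 * (g 0 * h (suc n)) + (f 0 * conv (g ∘ suc) h n + conv (f ∘ suc) (conv g h) n)
        ≈⟨ solve 4 (λ a b c d → a :* b :+ (a :* c :+ d) := a :* (b :+ c) :+ d) refl _ _ _ _ ⟩
      f 0 * (g 0 * h (suc n) + conv (g ∘ suc) h n) + conv (f ∘ suc) (conv g h) n ∎

    conv-identityˡ : ∀ f n → conv one f n ≈ f n
    conv-identityˡ f zero    = *-identityˡ _
    conv-identityˡ f (suc n) =
      trans (+-cong (*-identityˡ _) (conv-zeroˡ f n)) (+-identityʳ _)

  abstract
    series-isCommutativeRing : IsCommutativeRing (λ f g → ∀ n → f n ≈ g n) (λ f g n → f n + g n) conv (λ f n → - f n) (λ _ → 0#) one
    series-isCommutativeRing = record
      { isRing = record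
        { +-isAbelianGroup = record
          { isGroup = record
            { isMonoid = record
              { isSemigroup = record
                { isMagma = record
                  { isEquivalence = record
                    { refl = λ _ → refl ; sym = λ e n → sym (e n)
                    ; trans = λ e e′ n → trans (e n) (e′ n) }
                  ; ∙-cong = λ e e′ n → +-cong (e n) (e′ n) }
                ; assoc = λ f g h n → +-assoc _ _ _ }
              ; identity = (λ f n → +-identityˡ _) , (λ f n → +-identityʳ _) }
            ; inverse = (λ f n → -‿inverseˡ _) , (λ f n → -‿inverseʳ _)
            ; ⁻¹-cong = λ e n → -‿cong (e n) }
          ; comm = λ f g n → +-comm _ _ }
        ; *-cong = conv-cong
        ; *-assoc = conv-assoc
        ; *-identity = conv-identityˡ , λ f n → trans (conv-comm f one n) (conv-identityˡ f n)
        ; distrib = (λ f g h n → trans (conv-comm f _ n) (trans (conv-distribʳ f g h n)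
                      (+-cong (conv-comm g f n) (conv-comm h f n))))
                  , conv-distribʳ }
      ; *-comm = conv-comm }

  series : CR
  series = record
    { Carrier = ℕ → Carrier ; _≈_ = λ f g → ∀ n → f n ≈ g n
    ; _+_ = λ f g n → f n + g n ; _*_ = conv ; -_ = λ f n → - f n
    ; 0# = λ _ → 0# ; 1# = one
    ; isCommutativeRing = series-isCommutativeRing }

  coeff : List Carrier → ℕ → Carrier
  coeff []      n       = 0#
  coeff (a ∷ f) zero    = a
  coeff (a ∷ f) (suc n) = coeff f n

  infixl 6 _+ₚ_
  infixl 7 _*ₚ_
  _+ₚ_ _*ₚ_ : List Carrier → List Carrier → List Carrier
  []      +ₚ g       = g
  (a ∷ f) +ₚ []      = a ∷ f
  (a ∷ f) +ₚ (b ∷ g) = a + b ∷ f +ₚ g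
  []      *ₚ g = []
  (a ∷ f) *ₚ g = map (a *_) g +ₚ (0# ∷ f *ₚ g)

  private
    coeff-+ : ∀ f g n → coeff (f +ₚ g) n ≈ coeff f n + coeff g n
    coeff-+ []      g       n       = sym (+-identityˡ _)
    coeff-+ (a ∷ f) []      n       = sym (+-identityʳ _)
    coeff-+ (a ∷ f) (b ∷ g) zero    = refl
    coeff-+ (a ∷ f) (b ∷ g) (suc n) = coeff-+ f g n

    coeff-map : ∀ (φ : Carrier → Carrier) → φ 0# ≈ 0# → ∀ f n → coeff (map φ f) n ≈ φ (coeff f n)
    coeff-map φ φ0 []      n       = sym φ0
    coeff-map φ φ0 (a ∷ f) zero    = refl
    coeff-map φ φ0 (a ∷ f) (suc n) = coeff-map φ φ0 f n

    coeff-* : ∀ f g n → coeff (f *ₚ g) n ≈ conv (coeff f) (coeff g) n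
    coeff-* []      g n = sym (conv-zeroˡ (coeff g) n)
    coeff-* (a ∷ f) g n = trans (coeff-+ (map (a *_) g) _ n)
      (trans (+-congʳ (coeff-map (a *_) (zeroʳ a) g n)) (lemma n))
      where
      lemma : ∀ n → a * coeff g n + coeff (0# ∷ f *ₚ g) n ≈ conv (coeff (a ∷ f)) (coeff g) n
      lemma zero    = +-identityʳ _
      lemma (suc n) = +-congˡ (coeff-* f g n)

    coeff-1 : ∀ n → coeff (1# ∷ []) n ≈ one n
    coeff-1 zero    = refl
    coeff-1 (suc n) = refl

  -- Coefficients in increasing degree; trailing zeros are immaterial.
  rawPolynomials : RawRing 0ℓ 0ℓ
  rawPolynomials = record
    { Carrier = List Carrier ; _≈_ = λ f g → ∀ n → coeff f n ≈ coeff g n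
    ; _+_ = _+ₚ_ ; _*_ = _*ₚ_ ; -_ = map (λ a → - a) ; 0# = [] ; 1# = 1# ∷ [] }

  private
    coeff-isRingMonomorphism : RingMorphisms.IsRingMonomorphism
      rawPolynomials (CommutativeRing.rawRing series) coeff
    coeff-isRingMonomorphism = record
      { isRingHomomorphism = record
        { isSemiringHomomorphism = record
          { isNearSemiringHomomorphism = record
            { +-isMonoidHomomorphism = record
              { isMagmaHomomorphism = record
                { isRelHomomorphism = record { cong = id } ; homo = coeff-+ }
              ; ε-homo = λ _ → refl }
            ; *-homo = coeff-* }
          ; 1#-homo = coeff-1 }
        ; -‿homo = coeff-map (λ a → - a) -0#≈0# }
      ; injective = id }

  abstract
    polynomials-isCommutativeRing : IsCommutativeRing (RawRing._≈_ rawPolynomials)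
      _+ₚ_ _*ₚ_ (map (λ a → - a)) [] (1# ∷ [])
    polynomials-isCommutativeRing = RingMono.isCommutativeRing coeff-isRingMonomorphism
      (CommutativeRing.isCommutativeRing series)

  polynomials : CR
  polynomials = record { isCommutativeRing = polynomials-isCommutativeRing }

open Series using (coeff)

_[[T]] _[T] : CR → CR
R [[T]] = Series.series R
R [T]   = Series.polynomials R

module Polynomial (R : CR) where
  open Ring R

  T : List Carrier
  T = 0# ∷ 1# ∷ []

  HasDegree : ℕ → List Carrier → Set
  HasDegree n f = ¬ coeff R f n ≈ 0# × (∀ m → n ℕ.< m → coeff R f m ≈ 0#)

  Monic : ℕ → List Carrier → Set
  Monic n f = coeff R f n ≈ 1# × (∀ m → n ℕ.< m → coeff R f m ≈ 0#)

  derivative : List Carrier → List Carrier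
  derivative []      = []
  derivative (a ∷ f) = f +′ (0# ∷ derivative f)
    where _+′_ = CommutativeRing._+_ (R [T])

  -- The matrix of (u , v) ↦ u f + v g on deg u < n, deg v < m, where f and g
  -- have formal degrees m and n; columns are in decreasing degree.
  sylvester : ∀ m n → List Carrier → List Carrier → Matrix (n ℕ.+ m)
  sylvester m n f g i j =
    [ (λ i′ → row i′ f) , (λ i′ → row i′ g) ]′ (splitAt n i)
    where
    row : ∀ {k} → Fin k → List Carrier → Carrier
    row i′ h = coeff R (replicate (toℕ (opposite i′)) 0# ++ h) (toℕ (opposite j))

  -- a D = (-1)^(n(n-1)/2) Res(f , f′) for f of degree n with leading coefficient a.
  IsDiscriminant : ℕ → List Carrier → Carrier → Set
  IsDiscriminant n f D =
    coeff R f n * D ≈ (- 1#) ^ ℕ.⌊ n ℕ.* ℕ.pred n /2⌋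
                      * det _ (sylvester n (ℕ.pred n) f (derivative f))

  constant : Carrier → List Carrier
  constant a = a ∷ []

module _ (R S : CR) (φ : ⟨ R ⟩ → ⟨ S ⟩) where
  open Ring S

  evaluate : List ⟨ R ⟩ → ⟨ S ⟩ → ⟨ S ⟩
  evaluate f s = foldr (λ a v → φ a + s * v) 0# f

  IsIntegral : ⟨ S ⟩ → Set
  IsIntegral z = ∃[ n ] Σ[ c ∈ (Fin n → ⟨ R ⟩) ] z ^ n + sum (λ i → φ (c i) * z ^ toℕ i) ≈ 0#

-- Finite extensions of a field as towers of simple extensions L[T]/(f), with
-- the embedding of the base field.
data FiniteExtension (F : CR) : (L : CR) → (⟨ F ⟩ → ⟨ L ⟩) → Set₁ where
  trivial : FiniteExtension F F id
  adjoin  : ∀ {L φ} → FiniteExtension F L φ → (f : ⟨ L [T] ⟩) → Ring.Irreducible (L [T]) f →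
            FiniteExtension F ((L [T]) /⟨ f ⟩) (Polynomial.constant L ∘ φ)

------------------------------------------------------------------------
-- ℤ, ℚ, 𝔽ₚ and the p-adic rings

-- Sealed, because unfolding the library's proofs makes type checking very slow.
abstract
  ℤ-isCommutativeRing : IsCommutativeRing _≡_ ℤ._+_ ℤ._*_ ℤ.-_ (+ 0) (+ 1)
  ℤ-isCommutativeRing = ℤProps.+-*-isCommutativeRing

  ℚ-isCommutativeRing : IsCommutativeRing _≡_ ℚ._+_ ℚ._*_ ℚ.-_ ℚ.0ℚ ℚ.1ℚ
  ℚ-isCommutativeRing = ℚProps.+-*-isCommutativeRing

ℤᵣ ℚᵣ : CR
ℤᵣ = record { isCommutativeRing = ℤ-isCommutativeRing }
ℚᵣ = record { isCommutativeRing = ℚ-isCommutativeRing }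

𝔽 : ℕ → CR
𝔽 p = ℤᵣ /⟨ + p ⟩

-- The inverse limit of the rings ℤ/pⁿ.
module PadicIntegers (p : ℕ) where
  private
    module M (n : ℕ) = CommutativeRing (ℤᵣ /⟨ + (p ℕ.^ n) ⟩)

  record Coherent : Set where
    field
      seq      : ℕ → ℤ
      coherent : ∀ n → M._≈_ n (seq (suc n)) (seq n)
  open Coherent public

  _≈ᶜ_ : Rel Coherent 0ℓ
  a ≈ᶜ b = ∀ n → M._≈_ n (seq a n) (seq b n)

  _+ᶜ_ _*ᶜ_ : Coherent → Coherent → Coherent
  a +ᶜ b = record { seq = λ n → seq a n ℤ.+ seq b n
                  ; coherent = λ n → M.+-cong n (coherent a n) (coherent b n) }
  a *ᶜ b = record { seq = λ n → seq a n ℤ.* seq b n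
                  ; coherent = λ n → M.*-cong n (coherent a n) (coherent b n) }

  -ᶜ_ : Coherent → Coherent
  -ᶜ a = record { seq = λ n → ℤ.- seq a n ; coherent = λ n → M.-‿cong n (coherent a n) }

  constantᶜ : ℤ → Coherent
  constantᶜ a = record { seq = λ _ → a ; coherent = λ n → M.refl n }

  abstract
    padicIntegers-isCommutativeRing :
      IsCommutativeRing _≈ᶜ_ _+ᶜ_ _*ᶜ_ -ᶜ_ (constantᶜ (+ 0)) (constantᶜ (+ 1))
    padicIntegers-isCommutativeRing = record
      { isRing = record
        { +-isAbelianGroup = record
          { isGroup = record
            { isMonoid = record
              { isSemigroup = record
                { isMagma = record
                  { isEquivalence = record
                    { refl = λ n → M.refl n ; sym = λ e n → M.sym n (e n)
                    ; trans = λ e e′ n → M.trans n (e n) (e′ n) }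
                  ; ∙-cong = λ e e′ n → M.+-cong n (e n) (e′ n) }
                ; assoc = λ a b c n → M.+-assoc n (seq a n) (seq b n) (seq c n) }
              ; identity = (λ a n → M.+-identityˡ n (seq a n)) , (λ a n → M.+-identityʳ n (seq a n)) }
            ; inverse = (λ a n → M.-‿inverseˡ n (seq a n)) , (λ a n → M.-‿inverseʳ n (seq a n))
            ; ⁻¹-cong = λ e n → M.-‿cong n (e n) }
          ; comm = λ a b n → M.+-comm n (seq a n) (seq b n) }
        ; *-cong = λ e e′ n → M.*-cong n (e n) (e′ n)
        ; *-assoc = λ a b c n → M.*-assoc n (seq a n) (seq b n) (seq c n)
        ; *-identity = (λ a n → M.*-identityˡ n (seq a n)) , (λ a n → M.*-identityʳ n (seq a n))
        ; distrib = (λ a b c n → M.distribˡ n (seq a n) (seq b n) (seq c n))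
                  , (λ a b c n → M.distribʳ n (seq a n) (seq b n) (seq c n)) }
      ; *-comm = λ a b n → M.*-comm n (seq a n) (seq b n) }

  padicIntegers : CR
  padicIntegers = record { isCommutativeRing = padicIntegers-isCommutativeRing }

ℤₚ : ℕ → CR
ℤₚ p = PadicIntegers.padicIntegers p

-- Reduction ℤₚ → 𝔽ₚ.
residue : ∀ {p} → ⟨ ℤₚ p ⟩ → ⟨ 𝔽 p ⟩
residue a = PadicIntegers.seq a 1

------------------------------------------------------------------------
-- Functions on the curve 𝒬(x , y) = 0

data Chart : Set where
  finite infinite : Chart

-- The base change to A of the affine curve 𝒬 = 0; r is as in Curve below.
module Functions (d : ℕ) (𝒬 : ⟨ (ℤᵣ [T]) [T] ⟩) (r : ⟨ ℤᵣ [T] ⟩) (A : CR) where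
  private module P = Polynomial A

  𝒬ᴬ : ⟨ (A [T]) [T] ⟩
  𝒬ᴬ = map (map (Ring.fromℤ A)) 𝒬

  rᴬ : ⟨ A [T] ⟩
  rᴬ = map (Ring.fromℤ A) r

  -- A[x , 1/r] = A[x][1/r]  and  A[x , 1/x , 1/r] = A[x][1/(xr)].
  denominator : Chart → ⟨ A [T] ⟩
  denominator finite   = rᴬ
  denominator infinite = Ring._*_ (A [T]) P.T rᴬ

  Coefficient : Chart → CR
  Coefficient χ = (A [T]) [1/ denominator χ ]

  -- A[x , y , 1/x , 1/r]/(𝒬); it contains 1/x and all b⁰ⱼ , b^∞ⱼ.
  U : CR
  U = (((A [T]) [T]) /⟨ 𝒬ᴬ ⟩) [1/ Polynomial.constant (A [T]) (denominator infinite) ]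

  open Ring U

  scalar : ⟨ A ⟩ → ⟨ U ⟩
  scalar a = P.constant a ∷ [] , 0

  x x⁻¹ y : ⟨ U ⟩
  x   = P.T ∷ [] , 0
  x⁻¹ = rᴬ ∷ [] , 1
  y   = Polynomial.T (A [T]) , 0

  coefficient : ∀ χ → ⟨ Coefficient χ ⟩ → ⟨ U ⟩
  coefficient finite   (f , n) = Ring._*_ (A [T]) f (Ring._^_ (A [T]) P.T n) ∷ [] , n
  coefficient infinite (f , n) = f ∷ [] , n

  basis : ∀ χ → Ring.Matrix (Coefficient χ) d → Fin d → ⟨ U ⟩
  basis χ W j = sum (λ i → coefficient χ (W i j) * y ^ toℕ i)

  -- The loci r = 0 of Spec ℛ⁰ and x = ∞ of Spec ℛ^∞.
  boundary : Chart → ⟨ U ⟩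
  boundary finite   = rᴬ ∷ [] , 0
  boundary infinite = x⁻¹

  u : Chart → ⟨ U ⟩
  u finite   = x
  u infinite = x⁻¹

  atU : Chart → ⟨ A [T] ⟩ → ⟨ U ⟩
  atU χ f = evaluate A U scalar f (u χ)

  combination : ∀ χ → (Fin d → ⟨ U ⟩) → (Fin d → ⟨ A [T] ⟩) → ⟨ U ⟩
  combination χ b c = sum (λ j → atU χ (c j) * b j)

  -- The total ring of fractions of A[x , y]/(𝒬).
  FunctionField : CR
  FunctionField = Frac U

  embed : ⟨ U ⟩ → ⟨ FunctionField ⟩
  embed z = z , MultiplicativeSet.ε (regularElements U)

  IsIntegralBasis : ∀ χ → (Fin d → ⟨ U ⟩) → Set
  IsIntegralBasis χ b =
      (∀ z → IsIntegral (A [T]) FunctionField (embed ∘ atU χ) z ⇔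
             (∃[ c ] z ≈F embed (combination χ b c)))
    × (∀ c → embed (combination χ b c) ≈F 0F → ∀ j → Ring._≈_ (A [T]) (c j) (Ring.0# (A [T])))
    where open Ring FunctionField using () renaming (_≈_ to _≈F_; 0# to 0F)

-- On localisations at powers of one element, a map of numerators that carries
-- that element to the new one.
mapNumerator : ∀ {A B : Set} → (A → B) → A × ℕ → B × ℕ
mapNumerator φ (a , n) = φ a , n

-- A model of a curve X over ℚ; X itself is the nonsingular projective curve with
-- function field Frac ℚ[x , y]/(𝒬). Any genus is allowed.
record Curve : Set₁ where
  field
    d                        : ℕ
    𝒬                        : ⟨ (ℤᵣ [T]) [T] ⟩
    monic                    : Polynomial.Monic (ℤᵣ [T]) d 𝒬
    irreducible              : Ring.Irreducible ((ℤᵣ [T]) [T]) 𝒬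
    geometricallyIrreducible : ∀ {L φ} → FiniteExtension ℚᵣ L φ →
      Ring.Irreducible ((L [T]) [T]) (map (map (Ring.fromℤ L)) 𝒬)
    Δ gcdΔ r                 : ⟨ ℤᵣ [T] ⟩
    Δ-discriminant           : Polynomial.IsDiscriminant (ℤᵣ [T]) d 𝒬 Δ
    gcdΔ-gcd                 : Ring.IsGCD (ℤᵣ [T]) Δ (Polynomial.derivative ℤᵣ Δ) gcdΔ
    r-quotient               : Ring._≈_ (ℤᵣ [T]) (Ring._*_ (ℤᵣ [T]) r gcdΔ) Δ

  module Over = Functions d 𝒬 r

  field
    W              : ∀ χ → Ring.Matrix (Over.Coefficient ℚᵣ χ) d
    W-invertible   : ∀ χ → ∃[ V ] Ring.MutuallyInverse (Over.Coefficient ℚᵣ χ) (W χ) V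
    integralBasis  : ∀ χ → Over.IsIntegralBasis ℚᵣ χ (Over.basis ℚᵣ χ (W χ))

------------------------------------------------------------------------
-- Good reduction

ℚₚ : ℕ → CR
ℚₚ p = ℤₚ p ⊗ℚ

ℤₚ→ℚₚ : ∀ p → ⟨ ℤₚ p ⟩ → ⟨ ℚₚ p ⟩
ℤₚ→ℚₚ p a = a , 0

ℚ→ℚₚ : ∀ p → ⟨ ℚᵣ ⟩ → ⟨ ℚₚ p ⟩
ℚ→ℚₚ p q = Ring.fromℤ (ℤₚ p) (ℚ.↥ q) , ℚ.ℚ.denominator-1 q

-- ℛ = Σⱼ ℤₚ[u] bⱼ, for u = x or 1/x and a matrix W defining the bⱼ; its elements
-- are represented by their coordinates.
module Order (X : Curve) (p : ℕ) (χ : Chart)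
             (W : Ring.Matrix (Functions.Coefficient (Curve.d X) (Curve.𝒬 X) (Curve.r X) (ℤₚ p) χ) (Curve.d X))
             where
  open Curve X using (d; module Over)
  open Over (ℤₚ p) public
  open Ring U
  private module Z = Ring (ℤₚ p)

  ℛ : Set
  ℛ = Fin d → ⟨ ℤₚ p [T] ⟩

  b : Fin d → ⟨ U ⟩
  b = basis χ W

  ⟦_⟧ : ℛ → ⟨ U ⟩
  ⟦ c ⟧ = combination χ b c

  -- The kernel of ℛ → (ℛ/(m))_red, where m is r or 1/x.
  Radical : ⟨ U ⟩ → Set
  Radical z = ∃[ n ] Σ[ c ∈ ℛ ] z ^ n ≈ boundary χ * ⟦ c ⟧

  -- The discriminant of (ℛ/(m))_red is the determinant of the trace form on a
  -- ℤₚ-basis v, where vᵢ vⱼ = Σₖ γᵢⱼₖ vₖ.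
  HasUnitDiscriminant : Set
  HasUnitDiscriminant =
    ∃[ n ] Σ[ v ∈ (Fin n → ℛ) ] Σ[ γ ∈ (Fin n → Fin n → Fin n → ⟨ ℤₚ p ⟩) ]
      (∀ z → ∃[ a ] Radical (⟦ z ⟧ - linear v a))
    × (∀ a → Radical (linear v a) → ∀ i → a i Z.≈ Z.0#)
    × (∀ i j → Radical (⟦ v i ⟧ * ⟦ v j ⟧ - linear v (γ i j)))
    × Z.Unit (Z.det n (λ i j → trace γ (γ i j)))
    where
    linear : ∀ {n} → (Fin n → ℛ) → (Fin n → ⟨ ℤₚ p ⟩) → ⟨ U ⟩
    linear v a = sum (λ i → scalar (a i) * ⟦ v i ⟧)
    trace : ∀ {n} → (Fin n → Fin n → Fin n → ⟨ ℤₚ p ⟩) → (Fin n → ⟨ ℤₚ p ⟩) → ⟨ ℤₚ p ⟩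
    trace γ a = Z.sum (λ k → a k Z.* Z.sum (λ l → γ k l l))

record GoodReduction (X : Curve) (p : ℕ) : Set where
  open Curve X
  field
    discriminant-r : ∃[ n ] ∃[ D ] Polynomial.HasDegree ℤᵣ n r × Polynomial.IsDiscriminant ℤᵣ n r D
                       × Ring.Unit (ℤₚ p) (Ring.fromℤ (ℤₚ p) D)
    -- W⁰ and W^∞ as matrices over ℤₚ[x , 1/r] and ℤₚ[x , 1/x , 1/r].
    Wₚ             : ∀ χ → Ring.Matrix (Over.Coefficient (ℤₚ p) χ) d
    Wₚ-compatible  : ∀ χ i j → Ring._≈_ (Over.Coefficient (ℚₚ p) χ)
                       (mapNumerator (map (ℤₚ→ℚₚ p)) (Wₚ χ i j))
                       (mapNumerator (map (ℚ→ℚₚ p)) (W χ i j))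
    Wₚ-invertible  : ∀ χ → ∃[ V ] Ring.MutuallyInverse (Over.Coefficient (ℤₚ p) χ) (Wₚ χ) V
    reducedBasis   : ∀ χ → Over.IsIntegralBasis (𝔽 p) χ
                       (Over.basis (𝔽 p) χ (λ i j → mapNumerator (map residue) (Wₚ χ i j)))
    étale          : ∀ χ → Order.HasUnitDiscriminant X p χ (Wₚ χ)

------------------------------------------------------------------------
-- Points, residue disks and differentials

-- The functions u and bⱼ that generate ℛ as a ℤₚ-algebra.
data Generator (d : ℕ) : Set where
  base  : Generator d
  fibre : Fin d → Generator d

-- K = ℚₚ(p^(1/e)). As Tᵉ - p is an Eisenstein polynomial, its ring of integers is
-- 𝒪 = ℤₚ[T]/(Tᵉ - p), with uniformiser π = p^(1/e), and K = 𝒪 ⊗ ℚ.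
module Field (p e : ℕ) .{{e≢0 : NonZero e}} where
  private
    module P = Ring (ℤₚ p [T])
    Tᶻ = Polynomial.T (ℤₚ p)

  𝒪 : CR
  𝒪 = (ℤₚ p [T]) /⟨ Tᶻ P.^ e P.- P.fromℕ p ⟩

  K : CR
  K = 𝒪 ⊗ℚ

  π : ⟨ 𝒪 ⟩
  π = Tᶻ

  ℤₚ→𝒪 : ⟨ ℤₚ p ⟩ → ⟨ 𝒪 ⟩
  ℤₚ→𝒪 = Polynomial.constant (ℤₚ p)

  𝒪→K : ⟨ 𝒪 ⟩ → ⟨ K ⟩
  𝒪→K a = a , 0

  ℤₚ→K : ⟨ ℤₚ p ⟩ → ⟨ K ⟩
  ℤₚ→K = 𝒪→K ∘ ℤₚ→𝒪

  open Ring K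

  -- ord_p z ≥ ν, i.e. z ∈ π^(m-n) 𝒪 for some m and n with (m - n)/e ≥ ν.
  Ord≥ : ⟨ K ⟩ → ℚ → Set
  Ord≥ z ν = ∃[ m ] ∃[ n ] Σ[ a ∈ ⟨ 𝒪 ⟩ ]
    ν ℚ.≤ (m ⊖ n) ℚ./ e × 𝒪→K π ^ n * z ≈ 𝒪→K π ^ m * 𝒪→K a

  -- ord_p z = ν.
  Ord≡ : ⟨ K ⟩ → ℚ → Set
  Ord≡ z ν = ∃[ m ] ∃[ n ] Σ[ a ∈ ⟨ 𝒪 ⟩ ] Ring.Unit 𝒪 a ×
    ν ≡ (m ⊖ n) ℚ./ e × 𝒪→K π ^ n * z ≈ 𝒪→K π ^ m * 𝒪→K a

  CorrectTo : ℚ → ⟨ K ⟩ → ⟨ K ⟩ → Set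
  CorrectTo ν z̃ z = Ord≥ (z̃ - z) ν

  Inverse : ⟨ K ⟩ → ⟨ K ⟩ → Set
  Inverse z w = z * w ≈ 1#

  -- aᵢ tⁱ⁺¹/(i+1), or 0 if i = -1; t⁻¹ is the inverse of t.
  antiderivative : ⟨ K ⟩ → ⟨ K ⟩ → ⟨ K ⟩ → ℤ → ⟨ K ⟩
  antiderivative aᵢ t t⁻¹ (+ n)          = aᵢ * (Ring.1# 𝒪 , n) * t ^ suc n
  antiderivative aᵢ t t⁻¹ -[1+ zero ]    = 0#
  antiderivative aᵢ t t⁻¹ -[1+ suc n ]   = - (aᵢ * (Ring.1# 𝒪 , n) * t⁻¹ ^ suc n)

  -- The terms -k ≤ i < l - k of the tiny integral of Σ aᵢ tⁱ dt.
  integralUpTo : (k l : ℕ) (a : ℤ → ⟨ K ⟩) (tP tP⁻¹ tQ tQ⁻¹ : ⟨ K ⟩) → ⟨ K ⟩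
  integralUpTo k l a tP tP⁻¹ tQ tQ⁻¹ = sum {l} (λ n →
    let i = toℕ n ⊖ k in antiderivative (a i) tQ tQ⁻¹ i - antiderivative (a i) tP tP⁻¹ i)

  IsLimit : (ℕ → ⟨ K ⟩) → ⟨ K ⟩ → Set
  IsLimit z w = ∀ M → ∃[ n₀ ] ∀ n → n₀ ℕ.≤ n → CorrectTo (+ M ℚ./ 1) (z n) w

-- The smooth curve 𝒳 is Spec ℛ⁰ glued to Spec ℛ^∞ along x ≠ 0.
module Geometry (X : Curve) (p : ℕ) (G : GoodReduction X p) (e : ℕ) .{{e≢0 : NonZero e}} where
  open Curve X using (d; 𝒬; r)
  open GoodReduction G using (Wₚ)
  open Field p e public
  open Functions d 𝒬 r (ℤₚ p) using (U; scalar; x; FunctionField; embed; u)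
  private
    module U = Ring U
    module 𝒪 = Ring 𝒪
    module K = Ring K
    module F = Ring FunctionField

  ℛ : Set
  ℛ = Fin d → ⟨ ℤₚ p [T] ⟩

  element : Chart → ℛ → ⟨ U ⟩
  element χ = Order.⟦_⟧ X p χ (Wₚ χ)

  generator : Chart → Generator d → ⟨ U ⟩
  generator χ base      = u χ
  generator χ (fibre j) = Order.b X p χ (Wₚ χ) j

  Values : CR → Set
  Values A = Generator d → ⟨ A ⟩

  value : (A : CR) → (⟨ ℤₚ p ⟩ → ⟨ A ⟩) → Values A → ℛ → ⟨ A ⟩
  value A φ P c = sum (λ j → evaluate (ℤₚ p) A φ (c j) (P base) * P (fibre j))
    where open Ring A

  -- P extends to a homomorphism of ℤₚ-algebras ℛ → A (additivity and
  -- ℤₚ[u]-linearity are automatic), so it is an A-valued point of Spec ℛ.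
  IsPoint : (A : CR) → (⟨ ℤₚ p ⟩ → ⟨ A ⟩) → Chart → Values A → Set
  IsPoint A φ χ P =
      (∀ c c′ → element χ c U.≈ element χ c′ → ev c ≈ ev c′)
    × (∀ c c′ c″ → element χ c U.* element χ c′ U.≈ element χ c″ → ev c * ev c′ ≈ ev c″)
    × (∀ c → element χ c U.≈ U.1# → ev c ≈ 1#)
    where
    open Ring A
    ev = value A φ P

  𝔪 : ⟨ 𝒪 ⟩ → Set
  𝔪 a = π 𝒪.∣ a

  -- X(K) = 𝒳(𝒪) is the disjoint union of the 𝒪-points of Spec ℛ⁰ (the points in
  -- finite disks) and those of Spec ℛ^∞ at which 1/x reduces to 0 (infinite disks).
  record PointOver (χ : Chart) : Set where
    field
      at         : Values 𝒪
      isPoint    : IsPoint 𝒪 ℤₚ→𝒪 χ at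
      atInfinity : χ ≡ infinite → 𝔪 (at base)

    inK : Values K
    inK g = 𝒪→K (at g)
  open PointOver public

  SameDisk : ∀ {χ} → PointOver χ → PointOver χ → Set
  SameDisk P Q = ∀ g → 𝔪 (at P g 𝒪.- at Q g)

  VeryBad : (A : CR) → Chart → Values A → Set
  VeryBad A finite   P = evaluate ℤᵣ A (Ring.fromℤ A) r (P base) ≈ 0#
    where open Ring A
  VeryBad A infinite P = P base ≈ 0#
    ⊎ (∃[ ξ ] P base * ξ ≈ 1# × evaluate ℤᵣ A (Ring.fromℤ A) r ξ ≈ 0#)
    where open Ring A

  -- For L a finite extension of ℚₚ: ord_p z > 0, i.e. some power of z lies in p 𝒪_L.
  PositiveOrd : (L : CR) → (⟨ ℤₚ p ⟩ → ⟨ L ⟩) → ⟨ L ⟩ → Set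
  PositiveOrd L φ z = ∃[ n ] ∃[ v ] IsIntegral (ℤₚ p) L φ v × z ^ n ≈ fromℕ p * v
    where open Ring L

  InBadDisk : ∀ {χ} → PointOver χ → Set₁
  InBadDisk {χ} P =
    Σ[ L ∈ CR ] Σ[ φ ∈ (⟨ K ⟩ → ⟨ L ⟩) ] FiniteExtension K L φ ×
    Σ[ R ∈ Values L ] (IsPoint L (φ ∘ ℤₚ→K) χ R × VeryBad L χ R ×
      (∀ g → PositiveOrd L (φ ∘ ℤₚ→K) (Ring._-_ L (φ (inK P g)) (R g))))

  -- P′ is the very bad point of the disk of P if there is one, and P otherwise.
  -- The very bad point is unique, hence rational over ℚₚ ⊆ K.
  IsCentre : ∀ {χ} → PointOver χ → PointOver χ → Set₁
  IsCentre {χ} P P′ = (VeryBad K χ (inK P′) × SameDisk P P′)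
                    ⊎ (¬ InBadDisk P × (∀ g → at P′ g 𝒪.≈ at P g))

  -- The local coordinate attached to a generator h is h - h(P′), except that it is
  -- 1/x itself for h = 1/x.
  centreValue : (A : CR) → Chart → Values A → Generator d → ⟨ A ⟩
  centreValue A infinite P′ base      = Ring.0# A
  centreValue A finite   P′ base      = P′ base
  centreValue A χ        P′ (fibre j) = P′ (fibre j)

  localCoordinate : (A : CR) → Chart → Values A → Generator d → Values A → ⟨ A ⟩
  localCoordinate A χ P′ h P = Ring._-_ A (P h) (centreValue A χ P′ h)

  -- The reduction of t = h - h(P′) generates the maximal ideal of the local ring
  -- of 𝒳 ⊗ 𝔽ₚ at the reduction of P′; c is a lift to ℤₚ of h(P′) mod p.
  ReducesToUniformiser : ∀ {χ} → PointOver χ → Generator d → Set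
  ReducesToUniformiser {χ} P′ h =
    ∀ c → 𝔪 (ℤₚ→𝒪 c 𝒪.- centreValue 𝒪 χ (at P′) h) →
    ∀ z → 𝔪 (ev z) → ∃[ s ] ∃[ v ] ∃[ w ] ¬ 𝔪 (ev s) ×
      element χ s U.* element χ z U.≈
        (generator χ h U.- scalar c) U.* element χ v U.+ U.fromℕ p U.* element χ w
    where ev = value 𝒪 ℤₚ→𝒪 (at P′)

  ℤₚ→[[T]] : {A : CR} → (⟨ ℤₚ p ⟩ → ⟨ A ⟩) → ⟨ ℤₚ p ⟩ → ⟨ A [[T]] ⟩
  ℤₚ→[[T]] {A} φ a = coeff A (Polynomial.constant A (φ a))

  -- With ψ the formal parametrisation of X at P′ by a local parameter T.
  RamificationIndex : (A : CR) → Values (A [[T]]) → ℕ → Set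
  RamificationIndex A ψ n =
    0 ℕ.< n × ¬ ψ base n ≈ 0# × (∀ m → 0 ℕ.< m → m ℕ.< n → ψ base m ≈ 0#)
    where open Ring A

  -- The local coordinate t = h - h(P′) (or 1/x) on 𝒳, with the expansions of u and
  -- the bⱼ in powers of t; h = u exactly when x is unramified at P′.
  record LocalCoordinate {χ : Chart} (P′ : PointOver χ) : Set where
    field
      h               : Generator d
      uniformises     : ReducesToUniformiser P′ h
      expansion       : Values (K [[T]])
      isPoint         : IsPoint (K [[T]]) (ℤₚ→[[T]] {K} ℤₚ→K) χ expansion
      constantTerm    : ∀ h′ → expansion h′ 0 K.≈ inK P′ h′
      linearExpansion : Ring._≈_ (K [[T]])
        (localCoordinate (K [[T]]) χ (λ h′ → coeff K (inK P′ h′ ∷ [])) h expansion)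
        (coeff K (Polynomial.T K))
      choice          : (h ≡ base → RamificationIndex K expansion 1)
                      × (RamificationIndex K expansion 1 → h ≡ base)

  -- dx = (dx/du) du; on the infinite chart u = 1/x and dx = -x² du.
  dx/du : Chart → ⟨ U ⟩
  dx/du finite   = U.1#
  dx/du infinite = U.- (x U.* x)

  -- A meromorphic differential q dx on X over ℚₚ.
  record Differential : Set where
    constructor _dx
    field
      quotient : ⟨ FunctionField ⟩
  open Differential public

  -- ω has the expansion Σ aᵢ Tⁱ dT (i ≥ -k) along ψ: writing ω = (f/s) du with
  -- f, s ∈ ℛ, Tᵏ ψ(f) ψ(u)′ = ψ(s) Σ aᵢ Tⁱ⁺ᵏ.
  HasExpansion : (A : CR) → (⟨ ℤₚ p ⟩ → ⟨ A ⟩) → (χ : Chart) → Values (A [[T]]) →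
                 Differential → ℕ → (ℤ → ⟨ A ⟩) → Set
  HasExpansion A φ χ ψ ω k a = ∃[ f ] ∃[ s ] U.Regular (element χ s)
    × embed (element χ f) F.≈ quotient ω F.* embed (dx/du χ U.* element χ s)
    × coeff A (Polynomial.T A) ^ k * (ev f * derivative (ψ base)) ≈ ev s * (λ n → a (n ⊖ k))
    where
    open Ring (A [[T]])
    ev = value (A [[T]]) (ℤₚ→[[T]] {A} φ) ψ
    derivative : (ℕ → ⟨ A ⟩) → ℕ → ⟨ A ⟩
    derivative g n = Ring._⋆_ A (suc n) (g (suc n))

  -- All residues vanish, at all points over finite extensions L of K. The
  -- expansions ψ used are those in a formal local parameter T, i.e. those with
  -- some generator having a nonzero linear coefficient.
  SecondKind : Differential → Set₁
  SecondKind ω = ∀ {L φ} → FiniteExtension K L φ → ∀ χ (ψ : Values (L [[T]])) →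
    IsPoint (L [[T]]) (ℤₚ→[[T]] {L} (φ ∘ ℤₚ→K)) χ ψ → (∃[ h ] Ring.Unit L (ψ h 1)) →
    ∀ k a → .{{NonZero k}} → HasExpansion L (φ ∘ ℤₚ→K) χ ψ ω k a →
    Ring._≈_ L (a -[1+ 0 ]) (Ring.0# L)

  AccurateTo : ∀ {χ} → ℚ → Values K → PointOver χ → Set
  AccurateTo ν P̃ P = ∀ h → CorrectTo ν (P̃ h) (inK P h)

------------------------------------------------------------------------
-- The precision bounds

-- ⌊log_p m⌋ is the largest j ≤ m with pʲ ≤ m.
⌊log_⌋ : ℕ → ℕ → ℕ
⌊log p ⌋ m = search m
  where
  search : ℕ → ℕ
  search zero    = 0
  search (suc j) = if p ℕ.^ suc j ℕ.≤ᵇ m then suc j else search j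

IsMinimum : (ℕ → Set) → (ℕ → ℚ) → ℚ → Set
IsMinimum S f ν = (∃[ i ] S i × f i ≡ ν) × (∀ i → S i → ν ℚ.≤ f i)

module Bounds (p e : ℕ) .{{e≢0 : NonZero e}} where
  fromℕ : ℕ → ℚ
  fromℕ n = + n ℚ./ 1

  -- i/e - ⌊log_p (i+1)⌋
  term : ℕ → ℚ
  term i = + i ℚ./ e ℚ.- fromℕ (⌊log p ⌋ (suc i))

  ν₁ : (min : ℚ) → ℚ
  ν₁ min = + 1 ℚ./ e ℚ.+ min

  ν₂ : (N : ℕ) (min : ℚ) → ℚ
  ν₂ N min = fromℕ N ℚ.+ min

  ν₃ : (N k : ℕ) (ordP ordQ : ℚ) → ℚ ⁺
  ν₃ N (suc (suc k)) ordP ordQ =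
    [ fromℕ N ℚ.- fromℕ (suc (suc k)) ℚ.* (ordP ℚ.⊔ ordQ) ℚ.- fromℕ (⌊log p ⌋ (suc k)) ]
  ν₃ N _ ordP ordQ = ⊤⁺

_⊓⁺_ : ℚ → ℚ ⁺ → ℚ
ν ⊓⁺ [ ν′ ] = ν ℚ.⊓ ν′
ν ⊓⁺ ⊤⁺     = ν

-- Only the filtration of K by ord_p matters. Truncation discards terms aᵢ t(Q)ⁱ⁺¹/(i+1) and
-- aᵢ t(P)ⁱ⁺¹/(i+1) with i ≥ l; since ord t ≥ 1/e and ord (i+1) ≤ ⌊log_p (i+1)⌋, these are
-- bounded by ν₁. The terms with 0 ≤ i < l are off by (ãᵢ - aᵢ) t̃ⁱ⁺¹/(i+1) and
-- aᵢ (t̃ⁱ⁺¹ - tⁱ⁺¹)/(i+1), and t̃ - t, of order ≥ N, divides the latter: this is ν₂. For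
-- i ≤ -2 the same holds with t⁻¹ in place of t. As t̃ is nonzero to precision N, ord t < N;
-- hence ord t̃ = ord t =: o and t⁻¹ - t̃⁻¹ = (t̃ - t) t⁻¹ t̃⁻¹ has order ≥ N - 2 o, which gives ν₃.

module Submission where

open import Defs
open import Algebra.Bundles using (module CommutativeRing)
open import Algebra.Definitions.RawMagma using (_,_)
open import Algebra.Morphism.Structures using (module RingMorphisms)
import Algebra.Properties.Ring as RingProps
import Algebra.Properties.Semiring.Exp as SemiringExp
import Algebra.Properties.Semiring.Mult as SemiringMult
import Algebra.Solver.Ring.NaturalCoefficients.Default as SemiringSolver
open import Data.Bool.Base using (if_then_else_; true; false; T)
open import Data.Fin.Base using (toℕ)
open import Data.Integer.Base as ℤ using (ℤ; +_; -[1+_]; _⊖_)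
import Data.Integer.Properties as ℤProps
import Data.Integer.Solver as ℤSolver
open import Data.Nat.Base as ℕ using (ℕ; zero; suc; NonZero; z≤n; s≤s; _≤ᵇ_)
open import Data.Nat.Coprimality using (Coprime; coprime-Bézout)
import Data.Nat.Divisibility as ℕDiv
open import Data.Nat.GCD using (module Bézout)
open import Data.Nat.Induction using (<-rec)
open import Data.Nat.Primality using (Prime; prime⇒irreducible; prime⇒nonTrivial)
import Data.Nat.Properties as ℕProps
open import Data.Product.Base using (∃-syntax; Σ-syntax; _×_; _,_; proj₁; proj₂)
open import Data.Rational.Base as ℚ using (ℚ; mkℚ; 0ℚ; 1ℚ; _/_; toℚᵘ; fromℚᵘ; *≤*; *<*; _⊓_; _⊔_)
open import Data.Rational.Properties as ℚProps using
  ( toℚᵘ-fromℚᵘ; toℚᵘ-injective; toℚᵘ-homo-+; toℚᵘ-homo-*; toℚᵘ-cancel-≤; fromℚᵘ-cong; 0/n≡0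
  ; ≤-trans; ≤-reflexive; ≤-total; <⇒≤; ≰⇒>; _≤?_; +-monoʳ-≤; +-monoˡ-≤; +-monoˡ-<
  ; neg-antimono-≤; *-monoʳ-≤-nonNeg; *-monoˡ-≤-nonNeg
  ; p⊓q≤p; p⊓q≤q; p≤q⇒p⊓q≡p; p≥q⇒p⊓q≡q )
open import Data.Rational.Solver using (module +-*-Solver)
open import Data.Rational.Unnormalised.Base as ℚᵘ using (mkℚᵘ; *≡*; *≤*)
import Data.Rational.Unnormalised.Properties as ℚᵘProps
open import Data.Sum.Base using (inj₁; inj₂)
open import Relation.Binary.PropositionalEquality as ≡ using (_≡_; refl; sym; trans; cong; cong₂; subst)
import Relation.Binary.Reasoning.Setoid as SetoidReasoning
open import Relation.Nullary.Construct.Add.Supremum using (⊤⁺; [_])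
open import Relation.Nullary.Decidable using (yes; no)
open import Relation.Nullary.Negation using (¬_; contradiction)

-- Rational numbers

-- The order occurs only as a relation, `ord z ≥ ν`, witnessed by an integral multiple of a power of
-- π, so every step must be phrased with lower bounds. Two points then need a detour. The equality
-- of `ord t̃` and `ord t` is needed only as a lower bound for `ord t̃⁻¹`, and this is bootstrapped:
-- some bound exists, and each substitution into `t⁻¹ - t̃⁻¹ = (t̃ - t) t⁻¹ t̃⁻¹` improves it by
-- `N - o > 0` until it reaches `-o`. The sign of `o` is not immediate either, since the filtration
-- is not shown to be separated; but `o < 0` would give 1 a positive order, and then every element
-- has every order. The factor k in ν₃, although the worst power is only `t^(1-k)`, arises because
-- replacing one factor `t⁻¹` by `t̃⁻¹` costs 2o and the other k - 2 factors cost o each. The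
-- logarithms come from a divisibility statement in place of a valuation of integers: each `n ≥ 1`
-- divides some `pʲ ≤ n`, because integers prime to p are invertible in the inverse limit defining
-- ℤₚ.

private
  toℚᵘ-/ : ∀ i n → toℚᵘ (i / suc n) ℚᵘ.≃ mkℚᵘ i n
  toℚᵘ-/ i n = toℚᵘ-fromℚᵘ (mkℚᵘ i n)

/-homo-+ : ∀ i j n .{{_ : NonZero n}} → (i ℤ.+ j) / n ≡ i / n ℚ.+ j / n
/-homo-+ i j (suc n) = toℚᵘ-injective (begin
  toℚᵘ ((i ℤ.+ j) / suc n)              ≈⟨ toℚᵘ-/ (i ℤ.+ j) n ⟩
  mkℚᵘ (i ℤ.+ j) n                      ≈⟨ *≡* lemma ⟩
  mkℚᵘ i n ℚᵘ.+ mkℚᵘ j n                ≈⟨ ℚᵘProps.+-cong (toℚᵘ-/ i n) (toℚᵘ-/ j n) ⟨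
  toℚᵘ (i / suc n) ℚᵘ.+ toℚᵘ (j / suc n) ≈⟨ toℚᵘ-homo-+ (i / suc n) (j / suc n) ⟨
  toℚᵘ (i / suc n ℚ.+ j / suc n)        ∎)
  where
  open SetoidReasoning ℚᵘProps.≃-setoid
  d = + suc n
  lemma : (i ℤ.+ j) ℤ.* (d ℤ.* d) ≡ (i ℤ.* d ℤ.+ j ℤ.* d) ℤ.* d
  lemma = trans (sym (ℤProps.*-assoc (i ℤ.+ j) d d)) (cong (ℤ._* d) (ℤProps.*-distribʳ-+ d i j))

/-monoˡ-≤ : ∀ {i j} n .{{_ : NonZero n}} → i ℤ.≤ j → i / n ℚ.≤ j / n
/-monoˡ-≤ {i} {j} (suc n) i≤j = toℚᵘ-cancel-≤ (ℚᵘProps.≤-respˡ-≃ (ℚᵘProps.≃-sym (toℚᵘ-/ i n))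
  (ℚᵘProps.≤-respʳ-≃ (ℚᵘProps.≃-sym (toℚᵘ-/ j n)) (*≤* (ℤProps.*-monoʳ-≤-nonNeg (+ suc n) i≤j))))

[i*n]/n≡i/1 : ∀ i n .{{_ : NonZero n}} → (i ℤ.* + n) / n ≡ i / 1
[i*n]/n≡i/1 i (suc n) = fromℚᵘ-cong {mkℚᵘ (i ℤ.* + suc n) n} {mkℚᵘ i 0} (*≡* (ℤProps.*-identityʳ _))

neg-/ : ∀ i n .{{_ : NonZero n}} → (ℤ.- i) / n ≡ ℚ.- (i / n)
neg-/ i n = inverseˡ-unique (ℤ.- i / n) (i / n)
  (trans (sym (/-homo-+ (ℤ.- i) i n)) (trans (cong (_/ n) (ℤProps.+-inverseˡ i)) (0/n≡0 n)))
  where open import Algebra.Properties.Group ℚProps.+-0-group using (inverseˡ-unique)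

suc/1 : ∀ n → + suc n / 1 ≡ 1ℚ ℚ.+ + n / 1
suc/1 n = /-homo-+ (+ 1) (+ n) 1

0≤n/d : ∀ n d .{{_ : NonZero d}} → 0ℚ ℚ.≤ + n / d
0≤n/d n d = ≤-trans (≤-reflexive (sym (0/n≡0 d))) (/-monoˡ-≤ {i = + 0} {+ n} d (ℤ.+≤+ z≤n))

x≤x+d : ∀ x {d} → 0ℚ ℚ.≤ d → x ℚ.≤ x ℚ.+ d
x≤x+d x 0≤d = ≤-trans (≤-reflexive (sym (ℚProps.+-identityʳ x))) (+-monoʳ-≤ x 0≤d)

0<y-x : ∀ {x y} → x ℚ.< y → 0ℚ ℚ.< y ℚ.- x
0<y-x {x} {y} x<y = subst (ℚ._< y ℚ.- x) (ℚProps.+-inverseʳ x) (+-monoˡ-< (ℚ.- x) x<y)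

-- δ is at least the inverse of its denominator, so n = |numerator of x| * (denominator of δ) works.
archimedean : ∀ {δ} → 0ℚ ℚ.< δ → ∀ x → ∃[ n ] x ℚ.≤ + n / 1 ℚ.* δ
archimedean {mkℚ (+ suc a) d c} (*<* _) x@(mkℚ i d′ c′) = n , toℚᵘ-cancel-≤ (begin
  mkℚᵘ i d′                          ≤⟨ *≤* lemma ⟩
  mkℚᵘ (+ n) 0 ℚᵘ.* mkℚᵘ (+ suc a) d ≃⟨ ℚᵘProps.*-congʳ (toℚᵘ-/ (+ n) 0) ⟨
  toℚᵘ (+ n / 1) ℚᵘ.* toℚᵘ (mkℚ (+ suc a) d c) ≃⟨ toℚᵘ-homo-* (+ n / 1) (mkℚ (+ suc a) d c) ⟨
  toℚᵘ (+ n / 1 ℚ.* mkℚ (+ suc a) d c) ∎)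
  where
  open ℚᵘProps.≤-Reasoning
  n = ℤ.∣ i ∣ ℕ.* suc d
  i≤∣i∣ : ∀ i → i ℤ.≤ + ℤ.∣ i ∣
  i≤∣i∣ (+ _)    = ℤProps.≤-refl
  i≤∣i∣ -[1+ _ ] = ℤ.-≤+
  bound : ℤ.∣ i ∣ ℕ.* (1 ℕ.* suc d) ℕ.≤ n ℕ.* suc a ℕ.* suc d′
  bound = ℕProps.≤-trans (ℕProps.≤-reflexive (cong (ℤ.∣ i ∣ ℕ.*_) (ℕProps.*-identityˡ (suc d))))
    (ℕProps.≤-trans (ℕProps.m≤m*n n (suc a)) (ℕProps.m≤m*n (n ℕ.* suc a) (suc d′)))
  lemma : i ℤ.* + (1 ℕ.* suc d) ℤ.≤ + n ℤ.* + suc a ℤ.* + suc d′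
  lemma = ℤProps.≤-trans (ℤProps.*-monoʳ-≤-nonNeg (+ (1 ℕ.* suc d)) (i≤∣i∣ i))
    (≡.subst₂ ℤ._≤_ (ℤProps.pos-* ℤ.∣ i ∣ (1 ℕ.* suc d))
      (trans (ℤProps.pos-* (n ℕ.* suc a) (suc d′)) (cong (ℤ._* + suc d′) (ℤProps.pos-* n (suc a))))
      (ℤ.+≤+ bound))
archimedean {mkℚ (+ 0) _ _} (*<* (ℤ.+<+ ())) _
archimedean {mkℚ -[1+ _ ] _ _} (*<* ()) _

-- A fixed gain `δ`, iterated, passes every bound. Applied to `P = Ord z`, this turns a
-- self-improving estimate into an arbitrarily good one.
unbounded : ∀ {δ} → 0ℚ ℚ.< δ → (P : ℚ → Set) → (∀ x → P x → P (δ ℚ.+ x)) →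
            ∀ {x} → P x → ∀ y → ∃[ z ] y ℚ.≤ z × P z
unbounded {δ} 0<δ P step {x} px y = let n , y-x≤nδ = archimedean 0<δ (y ℚ.- x) in
  + n / 1 ℚ.* δ ℚ.+ x ,
  ≤-trans (≤-reflexive (solve 2 (λ y x → y := (y :- x) :+ x) refl y x)) (+-monoˡ-≤ x y-x≤nδ) , iterate n
  where
  open +-*-Solver
  iterate : ∀ n → P (+ n / 1 ℚ.* δ ℚ.+ x)
  iterate zero    = subst P (solve 2 (λ δ x → x := con 0ℚ :* δ :+ x) refl δ x) px
  iterate (suc n) = subst P
    (trans (solve 3 (λ n δ x → δ :+ (n :* δ :+ x) := (con 1ℚ :+ n) :* δ :+ x) refl (+ n / 1) δ x)
           (cong (λ m → m ℚ.* δ ℚ.+ x) (sym (suc/1 n))))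
    (step _ (iterate n))

-- Filtered rings

-- `Ord x ν` reads `ord x ≥ ν`; only such lower bounds occur, so `Ord-*` is superadditivity rather
-- than an equality. `Ord-any` excludes order minus infinity and provides the starting point of
-- iterated improvements.
record IsFiltration (R : CR) (Ord : ⟨ R ⟩ → ℚ → Set) : Set where
  open Ring R
  field
    Ord-resp   : ∀ {x y ν} → x ≈ y → Ord x ν → Ord y ν
    Ord-weaken : ∀ {x μ ν} → μ ℚ.≤ ν → Ord x ν → Ord x μ
    Ord-0#     : ∀ {ν} → Ord 0# ν
    Ord-1#     : Ord 1# 0ℚ
    Ord-+      : ∀ {x y ν} → Ord x ν → Ord y ν → Ord (x + y) ν
    Ord-neg    : ∀ {x ν} → Ord x ν → Ord (- x) ν
    Ord-*      : ∀ {x y μ ν} → Ord x μ → Ord y ν → Ord (x * y) (μ ℚ.+ ν)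
    Ord-any    : ∀ x → ∃[ ν ] Ord x ν

module Filtered {R : CR} {Ord : ⟨ R ⟩ → ℚ → Set} (isFiltration : IsFiltration R Ord) where
  open Ring R hiding (δ) renaming (refl to ≈-refl; sym to ≈-sym; trans to ≈-trans)
  open IsFiltration isFiltration public
  open RingProps ring
  open SetoidReasoning setoid
  private module S = SemiringSolver commutativeSemiring

  x-y≈[x-z]+[z-y] : ∀ x y z → x - y ≈ (x - z) + (z - y)
  x-y≈[x-z]+[z-y] x y z = begin
    x - y                 ≈⟨ +-identityʳ _ ⟨
    (x - y) + 0#          ≈⟨ +-congˡ (-‿inverseˡ z) ⟨
    (x - y) + (- z + z)   ≈⟨ S.solve 4 (λ x y′ z z′ → (x S.:+ y′) S.:+ (z′ S.:+ z) S.:= (x S.:+ z′) S.:+ (z S.:+ y′)) ≈-refl x (- y) z (- z) ⟩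
    (x - z) + (z - y)     ∎

  [x+y]-[z+w]≈[x-z]+[y-w] : ∀ x y z w → (x + y) - (z + w) ≈ (x - z) + (y - w)
  [x+y]-[z+w]≈[x-z]+[y-w] x y z w = begin
    (x + y) - (z + w)       ≈⟨ +-congˡ (-‿+-comm z w) ⟨
    (x + y) + (- z + - w)   ≈⟨ S.solve 4 (λ x y z′ w′ → (x S.:+ y) S.:+ (z′ S.:+ w′) S.:= (x S.:+ z′) S.:+ (y S.:+ w′)) ≈-refl x y (- z) (- w) ⟩
    (x - z) + (y - w)       ∎

  -‿anticomm : ∀ x y → - (x - y) ≈ y - x
  -‿anticomm x y = begin
    - (x - y)       ≈⟨ -‿+-comm x (- y) ⟨
    - x + - - y     ≈⟨ +-congˡ (-‿involutive y) ⟩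
    - x + y         ≈⟨ +-comm _ _ ⟩
    y - x           ∎

  Ord-swap : ∀ {x y ν} → Ord (x - y) ν → Ord (y - x) ν
  Ord-swap {x} {y} o = Ord-resp (-‿anticomm x y) (Ord-neg o)

  Ord-triangle : ∀ {x y ν} z → Ord (x - z) ν → Ord (z - y) ν → Ord (x - y) ν
  Ord-triangle z o o′ = Ord-resp (≈-sym (x-y≈[x-z]+[z-y] _ _ z)) (Ord-+ o o′)

  Ord-subtract : ∀ {x y ν} → Ord x ν → Ord y ν → Ord (x - y) ν
  Ord-subtract o o′ = Ord-+ o (Ord-neg o′)

  Ord-perturb : ∀ {x y ν} → Ord x ν → Ord (y - x) ν → Ord y ν
  Ord-perturb {x} {y} o o′ = Ord-resp
    (≈-trans (+-assoc y (- x) x) (≈-trans (+-congˡ (-‿inverseˡ x)) (+-identityʳ y))) (Ord-+ o′ o)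

  Ord-[-] : ∀ {x y z w ν} → Ord (x - z) ν → Ord (y - w) ν → Ord ((x - y) - (z - w)) ν
  Ord-[-] {x} {y} {z} {w} o o′ = Ord-resp
    (≈-sym (≈-trans ([x+y]-[z+w]≈[x-z]+[y-w] x (- y) z (- w)) (+-congˡ (-‿+-comm y (- w)))))
    (Ord-+ o (Ord-neg o′))

  Ord-^ : ∀ {x τ} → Ord x τ → ∀ n → Ord (x ^ n) (+ n / 1 ℚ.* τ)
  Ord-^ {x} {τ} o zero    = subst (Ord 1#) (sym (ℚProps.*-zeroˡ τ)) Ord-1#
  Ord-^ {x} {τ} o (suc n) = subst (Ord (x * x ^ n))
    (trans (solve 2 (λ n τ → τ :+ n :* τ := (con 1ℚ :+ n) :* τ) refl (+ n / 1) τ)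
           (cong (ℚ._* τ) (sym (suc/1 n))))
    (Ord-* o (Ord-^ o n))
    where open +-*-Solver

  -- Induction on `x xⁿ⁺¹ - y yⁿ⁺¹ = x (xⁿ⁺¹ - yⁿ⁺¹) + (x - y) yⁿ⁺¹`: one factor of each monomial is
  -- traded for `x - y`, the other `n` keep order `τ`.
  Ord-^-difference : ∀ {x y τ D} → Ord x τ → Ord y τ → Ord (x - y) D →
                     ∀ n → Ord (x ^ suc n - y ^ suc n) (D ℚ.+ + n / 1 ℚ.* τ)
  Ord-^-difference {x} {y} {τ} {D} ox oy od zero = Ord-resp
    (≈-sym (+-cong (*-identityʳ x) (-‿cong (*-identityʳ y))))
    (subst (Ord (x - y)) (solve 2 (λ D τ → D := D :+ con 0ℚ :* τ) refl D τ) od)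
    where open +-*-Solver
  Ord-^-difference {x} {y} {τ} {D} ox oy od (suc n) = Ord-triangle (x * y ^ suc n)
    (Ord-resp (x[y-z]≈xy-xz x _ _) (subst (Ord _)
      (trans (solve 3 (λ n τ D → τ :+ (D :+ n :* τ) := D :+ (con 1ℚ :+ n) :* τ) refl (+ n / 1) τ D)
             (cong (λ m → D ℚ.+ m ℚ.* τ) (sym (suc/1 n))))
      (Ord-* ox (Ord-^-difference ox oy od n))))
    (Ord-resp ([y-z]x≈yx-zx _ x y) (Ord-* od (Ord-^ oy (suc n))))
    where open +-*-Solver

  -- Compares a computed sum of `a` terms with a longer exact partial sum: matching terms are
  -- subtracted, and each surplus term counts as an error by itself.
  Ord-sum-difference : ∀ {ν} (f g : ℕ → Carrier) {a m} → a ℕ.≤ m →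
    (∀ n → n ℕ.< a → Ord (f n - g n) ν) → (∀ n → a ℕ.≤ n → Ord (g n) ν) →
    Ord (sum {a} (λ i → f (toℕ i)) - sum {m} (λ i → g (toℕ i))) ν
  Ord-sum-difference f g {zero} {zero} z≤n head tail = Ord-subtract Ord-0# Ord-0#
  Ord-sum-difference {ν} f g {zero} {suc m} z≤n head tail = Ord-resp
    (≈-trans (≈-sym ([x+y]-[z+w]≈[x-z]+[y-w] 0# 0# _ _)) (+-congʳ (+-identityʳ 0#)))
    (Ord-+ (Ord-subtract Ord-0# (tail 0 z≤n))
           (Ord-sum-difference f (λ n → g (suc n)) {zero} {m} z≤n (λ _ ()) (λ n _ → tail (suc n) z≤n)))
  Ord-sum-difference f g (s≤s a≤m) head tail = Ord-resp
    (≈-sym ([x+y]-[z+w]≈[x-z]+[y-w] _ _ _ _))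
    (Ord-+ (head 0 (s≤s z≤n))
           (Ord-sum-difference (λ n → f (suc n)) (λ n → g (suc n)) a≤m
             (λ n n<a → head (suc n) (s≤s n<a)) (λ n a≤n → tail (suc n) (s≤s a≤n))))

  Ord-term : ∀ {a c s γ σ} → Ord a 0ℚ → Ord c γ → Ord s σ →
             ∀ n → Ord (a * c * s ^ suc n) (γ ℚ.+ + suc n / 1 ℚ.* σ)
  Ord-term {γ = γ} oa oc os n = subst (λ x → Ord _ (x ℚ.+ _)) (ℚProps.+-identityˡ γ)
    (Ord-* (Ord-* oa oc) (Ord-^ os (suc n)))

  -- The coefficient error contributes order `α + γ + (n+1)σ`, the displacement of the point
  -- `γ + D + nσ`. The condition `D ≤ α + σ` makes the second the governing one. Stated for a
  -- general `s`, it serves for `t` and for its inverse.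
  Ord-term-difference : ∀ {a ã c s s̃ α γ D σ} → Ord a 0ℚ → Ord (ã - a) α → Ord c γ →
    Ord s σ → Ord s̃ σ → Ord (s̃ - s) D → D ℚ.≤ α ℚ.+ σ →
    ∀ n → Ord (ã * c * s̃ ^ suc n - a * c * s ^ suc n) (γ ℚ.+ (D ℚ.+ + n / 1 ℚ.* σ))
  Ord-term-difference {a} {ã} {c} {s} {s̃} {α} {γ} {D} {σ} oa oã oc os os̃ od D≤ n =
    Ord-triangle (a * c * s̃ ^ suc n)
      (Ord-resp (≈-trans (*-congʳ ([y-z]x≈yx-zx c ã a)) ([y-z]x≈yx-zx _ _ _))
        (Ord-weaken bound (Ord-* (Ord-* oã oc) (Ord-^ os̃ (suc n)))))
      (Ord-resp (x[y-z]≈xy-xz _ _ _)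
        (subst (Ord _) (solve 2 (λ γ y → (con 0ℚ :+ γ) :+ y := γ :+ y) refl γ _)
          (Ord-* (Ord-* oa oc) (Ord-^-difference os̃ os od n))))
    where
    open +-*-Solver
    bound : γ ℚ.+ (D ℚ.+ + n / 1 ℚ.* σ) ℚ.≤ (α ℚ.+ γ) ℚ.+ + suc n / 1 ℚ.* σ
    bound = ≤-trans (+-monoʳ-≤ γ (+-monoˡ-≤ (+ n / 1 ℚ.* σ) D≤)) (≤-reflexive
      (trans (solve 4 (λ α σ γ n → γ :+ ((α :+ σ) :+ n :* σ) := (α :+ γ) :+ (con 1ℚ :+ n) :* σ) refl α σ γ (+ n / 1))
             (cong (λ m → (α ℚ.+ γ) ℚ.+ m ℚ.* σ) (sym (suc/1 n)))))

  -- Disposes of the case ord t < 0 without having to show that the filtration is separated.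
  Ord-degenerate : ∀ {δ} → 0ℚ ℚ.< δ → Ord 1# δ → ∀ x ν → Ord x ν
  Ord-degenerate {δ} 0<δ o x ν =
    let μ , ox = Ord-any x
        z , ν-μ≤z , oz = unbounded 0<δ (Ord 1#) (λ _ o′ → Ord-resp (*-identityˡ 1#) (Ord-* o o′)) Ord-1# (ν ℚ.- μ)
    in Ord-resp (*-identityʳ x) (Ord-weaken
         (≤-trans (≤-reflexive (solve 2 (λ μ ν → ν := μ :+ (ν :- μ)) refl μ ν)) (+-monoʳ-≤ μ ν-μ≤z))
         (Ord-* ox oz))
    where open +-*-Solver

  inverse-difference : ∀ {t s t̃ s̃} → t * s ≈ 1# → t̃ * s̃ ≈ 1# → s - s̃ ≈ (t̃ - t) * s * s̃
  inverse-difference {t} {s} {t̃} {s̃} ts t̃s̃ = begin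
    s - s̃                       ≈⟨ +-cong (*-identityʳ s) (-‿cong (*-identityˡ s̃)) ⟨
    s * 1# - 1# * s̃             ≈⟨ +-cong (*-congˡ t̃s̃) (-‿cong (*-congʳ ts)) ⟨
    s * (t̃ * s̃) - t * s * s̃     ≈⟨ +-congʳ (S.solve 3 (λ s t s′ → s S.:* (t S.:* s′) S.:= t S.:* s S.:* s′) ≈-refl s t̃ s̃) ⟩
    t̃ * s * s̃ - t * s * s̃       ≈⟨ [y-z]x≈yx-zx s̃ _ _ ⟨
    (t̃ * s - t * s) * s̃         ≈⟨ *-congʳ ([y-z]x≈yx-zx s t̃ t) ⟨
    (t̃ - t) * s * s̃             ∎

  -- s̃ = s - (t̃ - t) s s̃ turns any lower bound for ord s̃ into one larger by α - o,
  -- as long as it does not exceed -o.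
  Ord-perturbed-inverse : ∀ {t s t̃ s̃ α o} → t * s ≈ 1# → t̃ * s̃ ≈ 1# →
    Ord s (ℚ.- o) → Ord (t̃ - t) α → o ℚ.< α → Ord s̃ (ℚ.- o)
  Ord-perturbed-inverse {t} {s} {t̃} {s̃} {α} {o} ts t̃s̃ os od o<α =
    let μ , os̃ = Ord-any s̃
        z , -o≤z , oz = unbounded 0<δ (λ x → Ord s̃ (x ⊓ (ℚ.- o))) step {μ}
                          (Ord-weaken (p⊓q≤p μ (ℚ.- o)) os̃) (ℚ.- o)
    in subst (Ord s̃) (p≥q⇒p⊓q≡q -o≤z) oz
    where
    δ = α ℚ.- o
    0<δ : 0ℚ ℚ.< δ
    0<δ = 0<y-x o<α
    step : ∀ x → Ord s̃ (x ⊓ (ℚ.- o)) → Ord s̃ ((δ ℚ.+ x) ⊓ (ℚ.- o))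
    step x ox = Ord-perturb (Ord-weaken (p⊓q≤q (δ ℚ.+ x) _) os)
      (Ord-swap (Ord-resp (≈-sym (inverse-difference ts t̃s̃)) (Ord-weaken bound (Ord-* (Ord-* od os) ox))))
      where
      bound : (δ ℚ.+ x) ⊓ (ℚ.- o) ℚ.≤ δ ℚ.+ (x ⊓ (ℚ.- o))
      bound with ≤-total x (ℚ.- o)
      ... | inj₁ x≤ = ≤-trans (p⊓q≤p (δ ℚ.+ x) _) (≤-reflexive (cong (δ ℚ.+_) (sym (p≤q⇒p⊓q≡p x≤))))
      ... | inj₂ ≤x = ≤-trans (p⊓q≤q (δ ℚ.+ x) _)
            (≤-trans (x≤x+d (ℚ.- o) (<⇒≤ 0<δ)) (≤-reflexive
              (trans (ℚProps.+-comm (ℚ.- o) δ) (cong (δ ℚ.+_) (sym (p≥q⇒p⊓q≡q ≤x))))))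

  -- The term of exponent `-(n+2)` involves `sⁿ⁺¹`. The displacement of `s` has order `α - 2o` and
  -- the remaining `n` factors have order `-o`, so the total is `α - (n+2)o - L`, which `n+2 ≤ k`
  -- and `o ≤ M` bound uniformly.
  Ord-negative-term-difference :
    ∀ {a ã c t s t̃ s̃ α o M L τ} → Ord a 0ℚ → Ord (ã - a) α → Ord c (ℚ.- L) →
    t * s ≈ 1# → t̃ * s̃ ≈ 1# → 0ℚ ℚ.< τ → Ord t τ → Ord t o → Ord s (ℚ.- o) →
    Ord (t̃ - t) α → ¬ Ord t̃ α → o ℚ.≤ M → ∀ {n k} → suc (suc n) ℕ.≤ k →
    Ord (- (ã * c * s̃ ^ suc n) - - (a * c * s ^ suc n)) (α ℚ.- + k / 1 ℚ.* M ℚ.- L)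
  Ord-negative-term-difference {a} {ã} {c} {t} {s} {t̃} {s̃} {α} {o} {M} {L} {τ}
    oa oã oc ts t̃s̃ 0<τ ot≥τ ot os od ¬ot̃ o≤M {n} {k} n+2≤k with 0ℚ ≤? o
  -- Passing from `(n+2)o` to `k o` needs `o ≥ 0`. Otherwise `t s = 1` has order at least
  -- `τ - o ≥ τ > 0`, and any bound holds.
  ... | no  o≱0 = Ord-degenerate 0<τ
        (Ord-weaken (x≤x+d τ (neg-antimono-≤ (<⇒≤ (≰⇒> o≱0))))
          (Ord-resp ts (Ord-* ot≥τ os))) _ _
  ... | yes 0≤o = Ord-resp (≈-sym (-‿+-comm _ _)) (Ord-neg (Ord-weaken bound
        (Ord-term-difference oa oã oc os os̃ (Ord-swap
          (Ord-resp (≈-sym (inverse-difference ts t̃s̃)) (Ord-* (Ord-* od os) os̃)))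
          D≤ n)))
    where
    open +-*-Solver
    o<α : o ℚ.< α
    o<α = ≰⇒> (λ α≤o → ¬ot̃ (Ord-perturb (Ord-weaken α≤o ot) od))
    os̃ : Ord s̃ (ℚ.- o)
    os̃ = Ord-perturbed-inverse ts t̃s̃ os od o<α
    D = (α ℚ.+ ℚ.- o) ℚ.+ ℚ.- o
    D≤ : D ℚ.≤ α ℚ.+ ℚ.- o
    D≤ = ≤-trans (+-monoʳ-≤ (α ℚ.+ ℚ.- o) (neg-antimono-≤ 0≤o)) (≤-reflexive (ℚProps.+-identityʳ _))
    n+2 : + suc (suc n) / 1 ≡ 1ℚ ℚ.+ (1ℚ ℚ.+ + n / 1)
    n+2 = trans (suc/1 (suc n)) (cong (1ℚ ℚ.+_) (suc/1 n))
    k*M : + suc (suc n) / 1 ℚ.* o ℚ.≤ + k / 1 ℚ.* M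
    k*M = ≤-trans
      (*-monoʳ-≤-nonNeg o {{ℚ.nonNegative 0≤o}} (/-monoˡ-≤ 1 (ℤ.+≤+ n+2≤k)))
      (*-monoˡ-≤-nonNeg (+ k / 1) {{ℚ.nonNegative (0≤n/d k 1)}} o≤M)
    bound : α ℚ.- + k / 1 ℚ.* M ℚ.- L ℚ.≤ ℚ.- L ℚ.+ (D ℚ.+ + n / 1 ℚ.* ℚ.- o)
    bound = ≤-trans (+-monoˡ-≤ (ℚ.- L) (+-monoʳ-≤ α (neg-antimono-≤ k*M)))
      (≤-reflexive (trans (cong (λ m → α ℚ.- m ℚ.* o ℚ.- L) n+2)
        (solve 4 (λ α o L n → α :- (con 1ℚ :+ (con 1ℚ :+ n)) :* o :- L
            := :- L :+ (((α :+ :- o) :+ :- o) :+ n :* :- o)) refl α o L (+ n / 1))))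

-- The integer logarithm

-- Names the function local to ⌊log_⌋: unification reads it off the unfolding, once the
-- two arguments suc m and m have been made independent of each other.
mutual
  search : ℕ → ℕ → ℕ → ℕ
  search = _

  ⌊log⌋-unfold : ∀ p m → ⌊log p ⌋ (suc m) ≡
                 (if p ℕ.^ suc m ≤ᵇ suc m then suc m else search p (suc m) m)
  ⌊log⌋-unfold p m with suc m
  ... | n = refl

search-greatest : ∀ p m {j} i → j ℕ.≤ i → p ℕ.^ j ℕ.≤ m → j ℕ.≤ search p m i
search-greatest p m zero z≤n _ = z≤n
search-greatest p m {j} (suc i) j≤1+i pʲ≤m with p ℕ.^ suc i ≤ᵇ m in eq
... | true  = j≤1+i
... | false with ℕProps.m≤n⇒m<n∨m≡n j≤1+i
...   | inj₁ (s≤s j≤i) = search-greatest p m i j≤i pʲ≤m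
...   | inj₂ refl      = contradiction (subst T eq (ℕProps.≤⇒≤ᵇ pʲ≤m)) λ ()

n<m^n : ∀ m n → 1 ℕ.< m → n ℕ.< m ℕ.^ n
n<m^n m zero    1<m = s≤s z≤n
n<m^n m (suc n) 1<m = begin-strict
  suc n                 <⟨ s≤s (n<m^n m n 1<m) ⟩
  suc (m ℕ.^ n)         ≤⟨ ℕProps.+-monoˡ-≤ (m ℕ.^ n) (ℕProps.≤-trans (s≤s z≤n) (n<m^n m n 1<m)) ⟩
  m ℕ.^ n ℕ.+ m ℕ.^ n   ≡⟨ cong (m ℕ.^ n ℕ.+_) (ℕProps.+-identityʳ (m ℕ.^ n)) ⟨
  2 ℕ.* m ℕ.^ n         ≤⟨ ℕProps.*-monoˡ-≤ (m ℕ.^ n) 1<m ⟩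
  m ℕ.* m ℕ.^ n         ∎
  where open ℕProps.≤-Reasoning

-- The downward search starts at `m` itself, which is high enough because `j < pʲ ≤ m`.
⌊log⌋-greatest : ∀ {p m j} → 1 ℕ.< p → p ℕ.^ j ℕ.≤ m → j ℕ.≤ ⌊log p ⌋ m
⌊log⌋-greatest {p} {zero}  {j} 1<p pʲ≤m = contradiction (ℕProps.≤-trans (n<m^n p j 1<p) pʲ≤m) λ ()
⌊log⌋-greatest {p} {suc m} {j} 1<p pʲ≤m = search-greatest p (suc m) (suc m)
  (ℕProps.<⇒≤ (ℕProps.<-≤-trans (n<m^n p j 1<p) pʲ≤m)) pʲ≤m

-- p-adic integers

module _ (p : ℕ) where
  open PadicIntegers p
  open Ring (ℤₚ p) using (fromℕ; _*_; _≈_; 1#)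
  private
    module Z = Ring (ℤₚ p)
    module S = ℤSolver.+-*-Solver

  seq-fromℕ : ∀ n m → seq (fromℕ n) m ≡ + n
  seq-fromℕ zero    m = refl
  seq-fromℕ (suc n) m = cong (ℤ._+_ (+ 1)) (seq-fromℕ n m)

  ≡⇒≈ : ∀ {a b : Coherent} → (∀ n → seq a n ≡ seq b n) → a ≈ b
  ≡⇒≈ {b = b} e n rewrite e n = Ring.refl (ℤᵣ /⟨ + (p ℕ.^ n) ⟩)

  -- u⁻¹ = x / (1 - p y) = x Σ (p y)ⁿ.
  invert : ∀ u x y → u ℤ.* x ℤ.+ + p ℤ.* y ≡ + 1 → ∃[ w ] constantᶜ u * w ≈ 1#
  invert u x y e = record { seq = λ n → x ℤ.* S n ; coherent = coherent′ } , inverse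
    where
    S : ℕ → ℤ
    S zero    = + 0
    S (suc n) = + 1 ℤ.+ + p ℤ.* y ℤ.* S n
    -- `S n` is the geometric sum of `(p y)ⁱ` over `i < n`; the quotient `d` is `yⁿ`.
    D : ∀ n → ∃[ d ] d ℤ.* + (p ℕ.^ n) ≡ S (suc n) ℤ.- S n
    D zero    = + 1 , S.solve 2 (λ p y → S.con (+ 1) S.:* S.con (+ 1) S.:= (S.con (+ 1) S.:+ p S.:* y S.:* S.con (+ 0)) S.:- S.con (+ 0)) refl (+ p) y
    D (suc n) = let d , eq = D n in y ℤ.* d , (begin
      y ℤ.* d ℤ.* + (p ℕ.* p ℕ.^ n)        ≡⟨ cong (y ℤ.* d ℤ.*_) (ℤProps.pos-* p (p ℕ.^ n)) ⟩
      y ℤ.* d ℤ.* (+ p ℤ.* + (p ℕ.^ n))    ≡⟨ S.solve 4 (λ y d p q → y S.:* d S.:* (p S.:* q) S.:= p S.:* y S.:* (d S.:* q)) refl y d (+ p) (+ (p ℕ.^ n)) ⟩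
      + p ℤ.* y ℤ.* (d ℤ.* + (p ℕ.^ n))    ≡⟨ cong (+ p ℤ.* y ℤ.*_) eq ⟩
      + p ℤ.* y ℤ.* (S (suc n) ℤ.- S n)    ≡⟨ S.solve 4 (λ p y s t → p S.:* y S.:* (s S.:- t) S.:= (S.con (+ 1) S.:+ p S.:* y S.:* s) S.:- (S.con (+ 1) S.:+ p S.:* y S.:* t)) refl (+ p) y (S (suc n)) (S n) ⟩
      S (suc (suc n)) ℤ.- S (suc n)        ∎)
      where open ≡.≡-Reasoning
    coherent′ : ∀ n → Congruent ℤᵣ (+ (p ℕ.^ n)) (x ℤ.* S (suc n)) (x ℤ.* S n)
    coherent′ n = let d , eq = D n in congruent (x ℤ.* d , trans (ℤProps.*-assoc x d _)
      (trans (cong (x ℤ.*_) eq) (S.solve 3 (λ x s t → x S.:* (s S.:- t) S.:= x S.:* s S.:- x S.:* t) refl x (S (suc n)) (S n))))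
    -- Since `u x = 1 - p y`, the sum telescopes: `u x S n - 1 = -(p y)ⁿ`, so `c` is `-yⁿ`.
    E : ∀ n → ∃[ c ] c ℤ.* + (p ℕ.^ n) ≡ u ℤ.* (x ℤ.* S n) ℤ.- + 1
    E zero    = ℤ.- (+ 1) , S.solve 2 (λ u x → S.con (ℤ.- (+ 1)) S.:* S.con (+ 1) S.:= u S.:* (x S.:* S.con (+ 0)) S.:- S.con (+ 1)) refl u x
    E (suc n) = let c , eq = E n in y ℤ.* c , (begin
      y ℤ.* c ℤ.* + (p ℕ.* p ℕ.^ n)        ≡⟨ cong (y ℤ.* c ℤ.*_) (ℤProps.pos-* p (p ℕ.^ n)) ⟩
      y ℤ.* c ℤ.* (+ p ℤ.* + (p ℕ.^ n))    ≡⟨ S.solve 4 (λ y d p q → y S.:* d S.:* (p S.:* q) S.:= p S.:* y S.:* (d S.:* q)) refl y c (+ p) (+ (p ℕ.^ n)) ⟩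
      + p ℤ.* y ℤ.* (c ℤ.* + (p ℕ.^ n))    ≡⟨ cong (+ p ℤ.* y ℤ.*_) eq ⟩
      + p ℤ.* y ℤ.* (u ℤ.* (x ℤ.* S n) ℤ.- + 1)
        ≡⟨ S.solve 5 (λ p y u x s → p S.:* y S.:* (u S.:* (x S.:* s) S.:- S.con (+ 1))
             S.:= u S.:* (x S.:* (S.con (+ 1) S.:+ p S.:* y S.:* s)) S.:- (u S.:* x S.:+ p S.:* y)) refl (+ p) y u x (S n) ⟩
      u ℤ.* (x ℤ.* S (suc n)) ℤ.- (u ℤ.* x ℤ.+ + p ℤ.* y)
        ≡⟨ cong (λ z → u ℤ.* (x ℤ.* S (suc n)) ℤ.- z) e ⟩
      u ℤ.* (x ℤ.* S (suc n)) ℤ.- + 1      ∎)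
      where open ≡.≡-Reasoning
    inverse : ∀ n → Congruent ℤᵣ (+ (p ℕ.^ n)) (u ℤ.* (x ℤ.* S n)) (+ 1)
    inverse n = let c , eq = E n in congruent (c , eq)

  coprime⇒unit : ∀ {n} → Coprime n p → ∃[ w ] fromℕ n * w ≈ 1#
  coprime⇒unit {n} c =
    let x , y , e = bézout (coprime-Bézout c)
        w , e′ = invert (+ n) x y e
    in w , Z.trans {fromℕ n * w} {constantᶜ (+ n) * w} {1#}
             (Z.*-congʳ {w} {fromℕ n} {constantᶜ (+ n)}
               (≡⇒≈ {fromℕ n} {constantᶜ (+ n)} (seq-fromℕ n))) e′
    where
    pos : ∀ {a b c d} → 1 ℕ.+ a ℕ.* b ≡ c ℕ.* d → + 1 ℤ.+ + a ℤ.* + b ≡ + c ℤ.* + d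
    pos {a} {b} {c} {d} eq = trans (cong (ℤ._+_ (+ 1)) (sym (ℤProps.pos-* a b)))
      (trans (cong +_ eq) (ℤProps.pos-* c d))
    bézout : Bézout.Identity 1 n p → ∃[ x ] ∃[ y ] + n ℤ.* x ℤ.+ + p ℤ.* y ≡ + 1
    bézout (Bézout.+- x y eq) = + x , ℤ.- (+ y) , trans
      (cong (ℤ._+ (+ p ℤ.* ℤ.- (+ y))) (trans (ℤProps.*-comm (+ n) (+ x)) (sym (pos {y} {p} {x} {n} eq))))
      (S.solve 2 (λ p y → (S.con (+ 1) S.:+ y S.:* p) S.:+ p S.:* (S.:- y) S.:= S.con (+ 1)) refl (+ p) (+ y))
    bézout (Bézout.-+ x y eq) = ℤ.- (+ x) , + y , trans
      (cong (ℤ._+_ (+ n ℤ.* ℤ.- (+ x))) (trans (ℤProps.*-comm (+ p) (+ y)) (sym (pos {x} {n} {y} {p} eq))))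
      (S.solve 2 (λ n x → n S.:* (S.:- x) S.:+ (S.con (+ 1) S.:+ x S.:* n) S.:= S.con (+ 1)) refl (+ n) (+ x))

module _ (R : CR) where
  open Ring R renaming (refl to ≈-refl; sym to ≈-sym; trans to ≈-trans)

  -- Factors `p` are split off by strong induction until the rest is prime to `p`, hence a unit. The
  -- inequality `pʲ ≤ n` will bound `j` by `⌊log_p n⌋`.
  divides-power : ∀ {p} → Prime p → (∀ {n} → Coprime n p → ∃[ w ] fromℕ n * w ≈ 1#) →
    ∀ n → .{{NonZero n}} → ∃[ j ] ∃[ w ] p ℕ.^ j ℕ.≤ n × fromℕ n * w ≈ fromℕ p ^ j
  divides-power {p} p-prime units = <-rec _ step
    where
    Goal : ℕ → Set
    Goal n = .{{NonZero n}} → ∃[ j ] ∃[ w ] p ℕ.^ j ℕ.≤ n × fromℕ n * w ≈ fromℕ p ^ j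
    1<p : 1 ℕ.< p
    1<p = ℕ.nonTrivial⇒n>1 p {{prime⇒nonTrivial p-prime}}
    step : ∀ n → (∀ {m} → m ℕ.< n → Goal m) → Goal n
    step n rec with p ℕDiv.∣? n
    ... | no p∤n = 0 , proj₁ unit , ℕ.>-nonZero⁻¹ n , proj₂ unit
      where
      coprime : Coprime n p
      coprime (d∣n , d∣p) with prime⇒irreducible p-prime d∣p
      ... | inj₁ d≡1  = d≡1
      ... | inj₂ refl = contradiction d∣n p∤n
      unit = units coprime
    ... | yes (ℕDiv.divides (suc q) refl) =
      let j , w , pʲ≤q , e = rec {suc q} (ℕProps.m<m*n (suc q) p 1<p) in
      suc j , w ,
      ℕProps.≤-trans (ℕProps.*-monoʳ-≤ p pʲ≤q) (ℕProps.≤-reflexive (ℕProps.*-comm p (suc q))) ,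
      (begin
        fromℕ (suc q ℕ.* p) * w           ≈⟨ *-congʳ (SemiringMult.×1-homo-* semiring (suc q) p) ⟩
        fromℕ (suc q) * fromℕ p * w       ≈⟨ *-congʳ (*-comm (fromℕ (suc q)) (fromℕ p)) ⟩
        fromℕ p * fromℕ (suc q) * w       ≈⟨ *-assoc (fromℕ p) (fromℕ (suc q)) w ⟩
        fromℕ p * (fromℕ (suc q) * w)     ≈⟨ *-congˡ e ⟩
        fromℕ p * fromℕ p ^ j             ∎)
      where open SetoidReasoning setoid

-- The filtration of K = 𝒪 ⊗ ℚ

⊖-homo-+ : ∀ m n m′ n′ → (m ℕ.+ m′) ⊖ (n ℕ.+ n′) ≡ (m ⊖ n) ℤ.+ (m′ ⊖ n′)
⊖-homo-+ m n m′ n′ = begin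
  (m ℕ.+ m′) ⊖ (n ℕ.+ n′)           ≡⟨ ℤProps.m-n≡m⊖n (m ℕ.+ m′) (n ℕ.+ n′) ⟨
  + (m ℕ.+ m′) ℤ.- + (n ℕ.+ n′)     ≡⟨ cong₂ ℤ._-_ (ℤProps.pos-+ m m′) (ℤProps.pos-+ n n′) ⟩
  (+ m ℤ.+ + m′) ℤ.- (+ n ℤ.+ + n′) ≡⟨ solve 4 (λ m n m′ n′ → (m :+ m′) :- (n :+ n′) := (m :- n) :+ (m′ :- n′)) refl (+ m) (+ n) (+ m′) (+ n′) ⟩
  (+ m ℤ.- + n) ℤ.+ (+ m′ ℤ.- + n′) ≡⟨ cong₂ ℤ._+_ (ℤProps.m-n≡m⊖n m n) (ℤProps.m-n≡m⊖n m′ n′) ⟩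
  (m ⊖ n) ℤ.+ (m′ ⊖ n′)             ∎
  where
  open ≡.≡-Reasoning
  open ℤSolver.+-*-Solver

-- `Ord≥` for an arbitrary map `ι` in place of `𝒪→K`. A pair of exponents stands for the integer
-- exponent `m - n`, since `ι π` is not assumed to be invertible.
PowerOrd : (A K : CR) → (⟨ A ⟩ → ⟨ K ⟩) → ⟨ A ⟩ → (e : ℕ) .{{_ : NonZero e}} → ⟨ K ⟩ → ℚ → Set
PowerOrd A K ι π e z ν =
  ∃[ m ] ∃[ n ] Σ[ a ∈ ⟨ A ⟩ ] ν ℚ.≤ (m ⊖ n) / e × ι π ^ n * z ≈ ι π ^ m * ι a
  where open Ring K

module PowerFiltration {A K : CR} {ι : ⟨ A ⟩ → ⟨ K ⟩}
  (isHomomorphism : RingMorphisms.IsRingHomomorphism (CommutativeRing.rawRing A) (CommutativeRing.rawRing K) ι)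
  (π : ⟨ A ⟩) (e : ℕ) .{{e≢0 : NonZero e}} where
  open Ring K renaming (refl to ≈-refl; sym to ≈-sym; trans to ≈-trans)
  private
    module A = Ring A
    module ι = RingMorphisms.IsRingHomomorphism isHomomorphism
    module S = SemiringSolver commutativeSemiring
  open RingProps ring using (-‿distribʳ-*)
  open SemiringExp semiring using (^-homo-*)
  open SetoidReasoning setoid

  Ord : Carrier → ℚ → Set
  Ord = PowerOrd A K ι π e

  ι-^ : ∀ a n → ι a ^ n ≈ ι (a A.^ n)
  ι-^ a zero    = ≈-sym ι.1#-homo
  ι-^ a (suc n) = ≈-trans (*-congˡ (ι-^ a n)) (≈-sym (ι.*-homo a (a A.^ n)))

  private
    scale : ∀ {m n z a} k → ι π ^ n * z ≈ ι π ^ m * a → ι π ^ (k ℕ.+ n) * z ≈ ι π ^ (k ℕ.+ m) * a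
    scale {m} {n} {z} {a} k eq = begin
      ι π ^ (k ℕ.+ n) * z         ≈⟨ *-congʳ (^-homo-* (ι π) k n) ⟩
      ι π ^ k * ι π ^ n * z       ≈⟨ *-assoc _ _ _ ⟩
      ι π ^ k * (ι π ^ n * z)     ≈⟨ *-congˡ eq ⟩
      ι π ^ k * (ι π ^ m * a)     ≈⟨ *-assoc _ _ _ ⟨
      ι π ^ k * ι π ^ m * a       ≈⟨ *-congʳ (^-homo-* (ι π) k m) ⟨
      ι π ^ (k ℕ.+ m) * a         ∎

    -- The last inequality says `m - n ≤ m′ - n′`. Both equations are scaled to the common
    -- denominator exponent `n′ + n`, never cancelled, and `π^(n′+m)` is taken out, leaving the
    -- integral cofactor `a + πᵈ a′`.
    Ord-+-ordered : ∀ {z z′ ν m n m′ n′ a a′} → ν ℚ.≤ (m ⊖ n) / e →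
      ι π ^ n * z ≈ ι π ^ m * ι a → ι π ^ n′ * z′ ≈ ι π ^ m′ * ι a′ →
      n′ ℕ.+ m ℕ.≤ n ℕ.+ m′ → Ord (z + z′) ν
    Ord-+-ordered {z} {z′} {ν} {m} {n} {m′} {n′} {a} {a′} ν≤ eq eq′ le =
      n′ ℕ.+ m , n′ ℕ.+ n , a A.+ π A.^ d A.* a′ ,
      subst (λ i → ν ℚ.≤ i / e) (sym (ℤProps.+-cancelˡ-⊖ n′ m n)) ν≤ , (begin
        ι π ^ (n′ ℕ.+ n) * (z + z′)                         ≈⟨ distribˡ _ z z′ ⟩
        ι π ^ (n′ ℕ.+ n) * z + ι π ^ (n′ ℕ.+ n) * z′        ≈⟨ +-cong (scale n′ eq) second ⟩
        ι π ^ (n′ ℕ.+ m) * ι a + ι π ^ (n′ ℕ.+ m) * (ι π ^ d * ι a′) ≈⟨ distribˡ _ _ _ ⟨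
        ι π ^ (n′ ℕ.+ m) * (ι a + ι π ^ d * ι a′)           ≈⟨ *-congˡ image ⟨
        ι π ^ (n′ ℕ.+ m) * ι (a A.+ π A.^ d A.* a′)         ∎)
      where
      d = (n ℕ.+ m′) ℕ.∸ (n′ ℕ.+ m)
      image : ι (a A.+ π A.^ d A.* a′) ≈ ι a + ι π ^ d * ι a′
      image = ≈-trans (ι.+-homo _ _) (+-congˡ (≈-trans (ι.*-homo _ _) (*-congʳ (≈-sym (ι-^ π d)))))
      second : ι π ^ (n′ ℕ.+ n) * z′ ≈ ι π ^ (n′ ℕ.+ m) * (ι π ^ d * ι a′)
      second = begin
        ι π ^ (n′ ℕ.+ n) * z′                   ≡⟨ cong (λ i → ι π ^ i * z′) (ℕProps.+-comm n′ n) ⟩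
        ι π ^ (n ℕ.+ n′) * z′                   ≈⟨ scale n eq′ ⟩
        ι π ^ (n ℕ.+ m′) * ι a′                 ≡⟨ cong (λ i → ι π ^ i * ι a′) (ℕProps.m+[n∸m]≡n le) ⟨
        ι π ^ (n′ ℕ.+ m ℕ.+ d) * ι a′           ≈⟨ *-congʳ (^-homo-* (ι π) (n′ ℕ.+ m) d) ⟩
        ι π ^ (n′ ℕ.+ m) * ι π ^ d * ι a′       ≈⟨ *-assoc _ _ _ ⟩
        ι π ^ (n′ ℕ.+ m) * (ι π ^ d * ι a′)     ∎

  Ord-ι : ∀ a → Ord (ι a) 0ℚ
  Ord-ι a = 0 , 0 , a , ≤-reflexive (sym (ℚProps.0/n≡0 e)) , ≈-refl

  Ord-π* : ∀ {z} a → z ≈ ι π * ι a → Ord z (+ 1 / e)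
  Ord-π* {z} a eq = 1 , 0 , a , ℚProps.≤-refl , (begin
    1# * z              ≈⟨ *-identityˡ z ⟩
    z                   ≈⟨ eq ⟩
    ι π * ι a           ≈⟨ *-congʳ (*-identityʳ (ι π)) ⟨
    ι π * 1# * ι a      ∎)

  -- If p = πᵉ, then z = a p⁻ʲ.
  Ord-π^* : ∀ {z} j a → ι π ^ (j ℕ.* e) * z ≈ ι a → Ord z (ℚ.- (+ j / 1))
  Ord-π^* {z} j a eq = 0 , j ℕ.* e , a , ≤-reflexive (sym exponent) , ≈-trans eq (≈-sym (*-identityˡ (ι a)))
    where
    exponent : (0 ⊖ (j ℕ.* e)) / e ≡ ℚ.- (+ j / 1)
    exponent = trans (cong (_/ e) (ℤProps.⊖-swap 0 (j ℕ.* e)))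
      (trans (neg-/ (+ (j ℕ.* e)) e) (cong ℚ.-_
        (trans (cong (_/ e) (ℤProps.pos-* j e)) ([i*n]/n≡i/1 (+ j) e))))

  Ord-difference : ∀ a b → π A.∣ a A.- b → Ord (ι a - ι b) (+ 1 / e)
  Ord-difference a b (q , qπ≈a-b) = Ord-π* q (begin
    ι a - ι b             ≈⟨ +-congˡ (ι.-‿homo b) ⟨
    ι a + ι (A.- b)       ≈⟨ ι.+-homo a (A.- b) ⟨
    ι (a A.- b)           ≈⟨ ι.⟦⟧-cong (A.trans (A.sym qπ≈a-b) (A.*-comm q π)) ⟩
    ι (π A.* q)           ≈⟨ ι.*-homo π q ⟩
    ι π * ι q             ∎)

  -- πᵐ w = πᵐ a b w = πⁿ z b w = πⁿ b.
  Ord-inverse : ∀ m n {z w a b} → z * w ≈ 1# → b A.* a A.≈ A.1# →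
                ι π ^ n * z ≈ ι π ^ m * ι a → Ord w (ℚ.- ((m ⊖ n) / e))
  Ord-inverse m n {z} {w} {a} {b} zw≈1 ba≈1 eq = n , m , b ,
    ≤-reflexive (sym (trans (cong (_/ e) (ℤProps.⊖-swap n m)) (neg-/ (m ⊖ n) e))) , ≈-sym (begin
      ι π ^ n * ι b                   ≈⟨ *-congˡ (≈-trans (*-congʳ zw≈1) (*-identityˡ (ι b))) ⟨
      ι π ^ n * (z * w * ι b)         ≈⟨ S.solve 4 (λ x z w b → x S.:* (z S.:* w S.:* b) S.:= (x S.:* z) S.:* (w S.:* b)) ≈-refl _ z w (ι b) ⟩
      (ι π ^ n * z) * (w * ι b)       ≈⟨ *-congʳ eq ⟩
      (ι π ^ m * ι a) * (w * ι b)     ≈⟨ S.solve 4 (λ x a w b → (x S.:* a) S.:* (w S.:* b) S.:= (x S.:* w) S.:* (b S.:* a)) ≈-refl _ (ι a) w (ι b) ⟩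
      (ι π ^ m * w) * (ι b * ι a)     ≈⟨ *-congˡ (≈-trans (≈-sym (ι.*-homo b a)) (≈-trans (ι.⟦⟧-cong ba≈1) ι.1#-homo)) ⟩
      (ι π ^ m * w) * 1#              ≈⟨ *-identityʳ _ ⟩
      ι π ^ m * w                     ∎)

  module _ (Ord-any : ∀ z → ∃[ ν ] Ord z ν) where
    -- All axioms but `Ord-any` are formal consequences of `ι` being a homomorphism. `Ord-any`
    -- depends on the denominators in `K`: they must divide powers of `π`.
    isFiltration : IsFiltration K Ord
    isFiltration = record
      { Ord-resp   = λ x≈y (m , n , a , ν≤ , eq) → m , n , a , ν≤ , ≈-trans (*-congˡ (≈-sym x≈y)) eq
      ; Ord-weaken = λ μ≤ν (m , n , a , ν≤ , eq) → m , n , a , ≤-trans μ≤ν ν≤ , eq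
      ; Ord-0#     = λ {ν} → large ν
      ; Ord-1#     = let m , n , a , ν≤ , eq = Ord-ι A.1# in m , n , a , ν≤ , ≈-trans (*-congˡ (≈-sym ι.1#-homo)) eq
      ; Ord-+      = add
      ; Ord-neg    = λ {x} (m , n , a , ν≤ , eq) → m , n , A.- a , ν≤ , (begin
          ι π ^ n * - x         ≈⟨ -‿distribʳ-* _ x ⟨
          - (ι π ^ n * x)       ≈⟨ -‿cong eq ⟩
          - (ι π ^ m * ι a)     ≈⟨ -‿distribʳ-* _ (ι a) ⟩
          ι π ^ m * - ι a       ≈⟨ *-congˡ (ι.-‿homo a) ⟨
          ι π ^ m * ι (A.- a)   ∎)
      ; Ord-*      = multiply
      ; Ord-any    = Ord-any
      }
      where
      large : ∀ ν → Ord 0# ν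
      large ν = let M , ν≤M = archimedean {1ℚ} (ℚ.*<* (ℤ.+<+ (s≤s z≤n))) ν in
        M ℕ.* e , 0 , A.0# ,
        ≤-trans ν≤M (≤-reflexive (trans (ℚProps.*-identityʳ (+ M / 1))
          (trans (sym ([i*n]/n≡i/1 (+ M) e)) (cong (_/ e) (sym (ℤProps.pos-* M e)))))) ,
        ≈-trans (zeroʳ _) (≈-sym (≈-trans (*-congˡ ι.0#-homo) (zeroʳ _)))
      add : ∀ {x y ν} → Ord x ν → Ord y ν → Ord (x + y) ν
      add {x} {y} (m , n , a , ν≤ , eq) (m′ , n′ , a′ , ν≤′ , eq′)
        with ℕProps.≤-total (n′ ℕ.+ m) (n ℕ.+ m′)
      ... | inj₁ le = Ord-+-ordered {m = m} {n} {m′} {n′} ν≤ eq eq′ le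
      ... | inj₂ le = let m″ , n″ , a″ , ν≤″ , eq″ = Ord-+-ordered {m = m′} {n′} {m} {n} ν≤′ eq′ eq le in
                      m″ , n″ , a″ , ν≤″ , ≈-trans (*-congˡ (+-comm x y)) eq″
      multiply : ∀ {x y μ ν} → Ord x μ → Ord y ν → Ord (x * y) (μ ℚ.+ ν)
      multiply {x} {y} (m , n , a , μ≤ , eq) (m′ , n′ , a′ , ν≤ , eq′) =
        m ℕ.+ m′ , n ℕ.+ n′ , a A.* a′ ,
        ≤-trans (ℚProps.+-mono-≤ μ≤ ν≤) (≤-reflexive
          (trans (sym (/-homo-+ (m ⊖ n) (m′ ⊖ n′) e)) (cong (_/ e) (sym (⊖-homo-+ m n m′ n′))))) , (begin
        ι π ^ (n ℕ.+ n′) * (x * y)          ≈⟨ *-congʳ (^-homo-* (ι π) n n′) ⟩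
        ι π ^ n * ι π ^ n′ * (x * y)        ≈⟨ interchange (ι π ^ n) (ι π ^ n′) x y ⟩
        (ι π ^ n * x) * (ι π ^ n′ * y)      ≈⟨ *-cong eq eq′ ⟩
        (ι π ^ m * ι a) * (ι π ^ m′ * ι a′) ≈⟨ interchange (ι π ^ m) (ι π ^ m′) (ι a) (ι a′) ⟨
        ι π ^ m * ι π ^ m′ * (ι a * ι a′)   ≈⟨ *-cong (^-homo-* (ι π) m m′) (ι.*-homo a a′) ⟨
        ι π ^ (m ℕ.+ m′) * ι (a A.* a′)     ∎)
        where
        interchange : ∀ a b c d → a * b * (c * d) ≈ (a * c) * (b * d)
        interchange = S.solve 4 (λ a b c d → a S.:* b S.:* (c S.:* d) S.:= (a S.:* c) S.:* (b S.:* d)) ≈-refl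

module _ (R : CR) where
  open Ring R renaming (refl to ≈-refl; sym to ≈-sym; trans to ≈-trans)
  private
    module S = SemiringSolver commutativeSemiring
    module M = MultiplicativeSet (positiveIntegers R)
    L = Localisation._≃_ R (positiveIntegers R)

    cross : ∀ {a i b j} → a * M.σ j ≈ b * M.σ i → L (a , i) (b , j)
    cross eq = Localisation._,_ 0 (*-congˡ eq)

    σ0≈1 : M.σ 0 ≈ 1#
    σ0≈1 = +-identityʳ 1#

  toRational-isHomomorphism : RingMorphisms.IsRingHomomorphism
    (CommutativeRing.rawRing R) (CommutativeRing.rawRing (R ⊗ℚ)) (_, 0)
  toRational-isHomomorphism = record
    { isSemiringHomomorphism = record
      { isNearSemiringHomomorphism = record
        { +-isMonoidHomomorphism = record
          { isMagmaHomomorphism = record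
            { isRelHomomorphism = record { cong = λ eq → cross (*-congʳ eq) }
            ; homo = λ a b → cross (*-congʳ (≈-sym (+-cong (unit a) (unit b)))) }
          ; ε-homo = cross ≈-refl }
        ; *-homo = λ a b → cross ≈-refl }
      ; 1#-homo = cross ≈-refl }
    ; -‿homo = λ a → cross ≈-refl }
    where
    unit : ∀ a → a * M.σ 0 ≈ a
    unit a = ≈-trans (*-congˡ σ0≈1) (*-identityʳ a)

  cancel-denominator : ∀ n a → Ring._≈_ (R ⊗ℚ) (Ring._*_ (R ⊗ℚ) (fromℕ (suc n) * a , 0) (1# , n)) (a , 0)
  cancel-denominator n a = cross (begin
    fromℕ (suc n) * a * 1# * M.σ 0   ≈⟨ S.solve 3 (λ f a s → f S.:* a S.:* S.con 1 S.:* s S.:= a S.:* (s S.:* f)) ≈-refl (fromℕ (suc n)) a (M.σ 0) ⟩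
    a * (M.σ 0 * M.σ n)              ≈⟨ *-congˡ (M.σ-∙ 0 n) ⟨
    a * M.σ (0 M.∙ n)                ∎)
    where open SetoidReasoning setoid

  split-denominator : ∀ n a → Ring._≈_ (R ⊗ℚ) (Ring._*_ (R ⊗ℚ) (a , 0) (1# , n)) (a , n)
  split-denominator n a = cross (begin
    a * 1# * M.σ n             ≈⟨ *-congˡ (≈-trans (*-congʳ σ0≈1) (*-identityˡ (M.σ n))) ⟨
    a * 1# * (M.σ 0 * M.σ n)   ≈⟨ *-cong (*-identityʳ a) (≈-sym (M.σ-∙ 0 n)) ⟩
    a * M.σ (0 M.∙ n)          ∎)
    where open SetoidReasoning setoid

  module RationalFiltration {p e} .{{_ : NonZero e}} {π} (p-prime : Prime p)
    (πᵉ≈p : π ^ e ≈ fromℕ p) (units : ∀ {n} → Coprime n p → ∃[ w ] fromℕ n * w ≈ 1#) where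
    open PowerFiltration {R} {R ⊗ℚ} {_, 0} toRational-isHomomorphism π e public
    private
      module K = Ring (R ⊗ℚ)
      module ι = RingMorphisms.IsRingHomomorphism toRational-isHomomorphism

    1<p : 1 ℕ.< p
    1<p = ℕ.nonTrivial⇒n>1 p {{prime⇒nonTrivial p-prime}}

    private
      π-power : ∀ j → π ^ (j ℕ.* e) ≈ fromℕ p ^ j
      π-power j = ≈-trans (reflexive (cong (π ^_) (ℕProps.*-comm j e)))
        (≈-trans (≈-sym (SemiringExp.^-assocʳ semiring π e j)) (SemiringExp.^-congˡ semiring j πᵉ≈p))

    -- Index `n` means the denominator `n+1`. From `(n+1) w = pʲ = π^(je)`, multiplication by
    -- `π^(je)` turns `1/(n+1)` into the integral `w`. The free upper bound `m` allows one
    -- logarithm, that of `k-1`, for all polar terms.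
    Ord-reciprocal : ∀ n m → suc n ℕ.≤ m → Ord (1# , n) (ℚ.- (+ ⌊log p ⌋ m / 1))
    Ord-reciprocal n m n<m =
      let j , w , pʲ≤1+n , eq = divides-power R p-prime units (suc n)
          m′ , n′ , a , ν≤ , eq′ = Ord-π^* j w (begin
            (π , 0) K.^ (j ℕ.* e) K.* (1# , n)      ≈⟨ K.*-congʳ {x = 1# , n} (ι-^ π (j ℕ.* e)) ⟩
            (π ^ (j ℕ.* e) , 0) K.* (1# , n)        ≈⟨ K.*-congʳ {x = 1# , n} (ι.⟦⟧-cong (≈-trans (π-power j) (≈-sym eq))) ⟩
            (fromℕ (suc n) * w , 0) K.* (1# , n)    ≈⟨ cancel-denominator n w ⟩
            (w , 0)                                 ∎)
      in m′ , n′ , a , ≤-trans (ℚProps.neg-antimono-≤ (/-monoˡ-≤ {+ j} {+ ⌊log p ⌋ m} 1 (ℤ.+≤+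
           (⌊log⌋-greatest {p} {m} {j} 1<p (ℕProps.≤-trans pʲ≤1+n n<m))))) ν≤ , eq′
      where open SetoidReasoning K.setoid

    rational-isFiltration : IsFiltration (R ⊗ℚ) Ord
    rational-isFiltration = isFiltration any
      where
      any : ∀ z → ∃[ ν ] Ord z ν
      any (a , n) = let m′ , n′ , b , ν≤ , eq = Ord-reciprocal n (suc n) ℕProps.≤-refl in
        _ , m′ , n′ , a * b , ν≤ , (begin
          (π , 0) K.^ n′ K.* (a , n)                    ≈⟨ K.*-congˡ {(π , 0) K.^ n′} (split-denominator n a) ⟨
          (π , 0) K.^ n′ K.* ((a , 0) K.* (1# , n))     ≈⟨ swap ((π , 0) K.^ n′) (a , 0) (1# , n) ⟩
          (a , 0) K.* ((π , 0) K.^ n′ K.* (1# , n))     ≈⟨ K.*-congˡ {a , 0} eq ⟩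
          (a , 0) K.* ((π , 0) K.^ m′ K.* (b , 0))      ≈⟨ swap (a , 0) ((π , 0) K.^ m′) (b , 0) ⟩
          (π , 0) K.^ m′ K.* (a * b , 0)                ∎)
        where
        open SetoidReasoning K.setoid
        swap : ∀ x y z → x K.* (y K.* z) K.≈ y K.* (x K.* z)
        swap x y z = K.trans {x K.* (y K.* z)} {x K.* y K.* z} {y K.* (x K.* z)} (K.sym {x K.* y K.* z} (K.*-assoc x y z))
          (K.trans {x K.* y K.* z} {y K.* x K.* z} (K.*-congʳ {z} (K.*-comm x y)) (K.*-assoc y x z))

-- The field K

≈⇒Congruent : ∀ (R : CR) {f a b} → Ring._≈_ R a b → Congruent R f a b
≈⇒Congruent R {f} {b = b} a≈b =
  congruent (0# , R.trans (zeroˡ f) (R.sym (R.trans (+-congʳ a≈b) (-‿inverseʳ b))))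
  where
  module R = Ring R
  open R

module _ (R : CR) where
  private
    module R = Ring R
    module P = Ring (R [T])
  open Polynomial R using (constant)

  constant-fromℕ : ∀ n → constant (R.fromℕ n) P.≈ P.fromℕ n
  constant-fromℕ zero    zero    = R.refl
  constant-fromℕ zero    (suc m) = R.refl
  constant-fromℕ (suc n) m = R.trans (unfold m) (P.+-cong {P.1#} {P.1#} {constant (R.fromℕ n)} {P.fromℕ n} (λ _ → R.refl) (constant-fromℕ n) m)
    where
    unfold : ∀ m → Series.coeff R (constant (R.fromℕ (suc n))) m R.≈ Series.coeff R (P.1# P.+ constant (R.fromℕ n)) m
    unfold zero    = R.refl
    unfold (suc m) = R.refl

  constant-* : ∀ a b → constant a P.* constant b P.≈ constant (a R.* b)
  constant-* a b zero    = R.+-identityʳ (a R.* b)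
  constant-* a b (suc n) = R.refl

  constant-cong : ∀ {a b} → a R.≈ b → constant a P.≈ constant b
  constant-cong eq zero    = eq
  constant-cong eq (suc n) = R.refl

module PadicField (p e : ℕ) .{{e≢0 : NonZero e}} (p-prime : Prime p) where
  open Field p e
  private
    module Z = Ring (ℤₚ p)
    module P = Ring (ℤₚ p [T])
    module O = Ring 𝒪
    module K = Ring K

  -- The quotient keeps the carrier and operations of ℤₚ[T] and changes only its equality, so powers
  -- agree as representatives.
  quotient-^ : ∀ a n → a P.^ n ≡ a O.^ n
  quotient-^ a zero    = refl
  quotient-^ a (suc n) = cong (a P.*_) (quotient-^ a n)

  quotient-fromℕ : ∀ n → P.fromℕ n ≡ O.fromℕ n
  quotient-fromℕ zero    = refl
  quotient-fromℕ (suc n) = cong (P.1# P.+_) (quotient-fromℕ n)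

  πᵉ≈p : π O.^ e O.≈ O.fromℕ p
  πᵉ≈p = ≡.subst₂ O._≈_ (quotient-^ π e) (quotient-fromℕ p)
    (congruent (P.1# , P.*-identityˡ (π P.^ e P.- P.fromℕ p)))

  𝒪-coprime⇒unit : ∀ {n} → Coprime n p → ∃[ w ] O.fromℕ n O.* w O.≈ O.1#
  𝒪-coprime⇒unit {n} c = let w , eq = coprime⇒unit p c in
    ℤₚ→𝒪 w , subst (λ f → f O.* ℤₚ→𝒪 w O.≈ O.1#) (quotient-fromℕ n)
      (≈⇒Congruent (ℤₚ p [T]) {a = P.fromℕ n P.* ℤₚ→𝒪 w} {P.1#} (begin
        P.fromℕ n P.* ℤₚ→𝒪 w              ≈⟨ P.*-congʳ {ℤₚ→𝒪 w} {P.fromℕ n} {ℤₚ→𝒪 (Z.fromℕ n)} (P.sym {ℤₚ→𝒪 (Z.fromℕ n)} {P.fromℕ n} (constant-fromℕ (ℤₚ p) n)) ⟩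
        ℤₚ→𝒪 (Z.fromℕ n) P.* ℤₚ→𝒪 w      ≈⟨ constant-* (ℤₚ p) (Z.fromℕ n) w ⟩
        ℤₚ→𝒪 (Z.fromℕ n Z.* w)           ≈⟨ constant-cong (ℤₚ p) {Z.fromℕ n Z.* w} {Z.1#} eq ⟩
        P.1#                              ∎))
    where open SetoidReasoning P.setoid

  private
    module F = RationalFiltration 𝒪 {p} {e} {π} p-prime πᵉ≈p 𝒪-coprime⇒unit
    module V = IsFiltration F.rational-isFiltration

  -- Given field by field: convertibility of K and 𝒪 ⊗ℚ as indices of IsFiltration is expensive to check.
  abstract
    K-isFiltration : IsFiltration K Ord≥
    K-isFiltration = record
      { Ord-resp = V.Ord-resp ; Ord-weaken = V.Ord-weaken ; Ord-0# = V.Ord-0# ; Ord-1# = V.Ord-1#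
      ; Ord-+ = V.Ord-+ ; Ord-neg = V.Ord-neg ; Ord-* = V.Ord-* ; Ord-any = V.Ord-any }

  abstract
    Ord≥-integral : ∀ a → Ord≥ (𝒪→K a) 0ℚ
    Ord≥-integral = F.Ord-ι

    Ord≥-reciprocal : ∀ n m → suc n ℕ.≤ m → Ord≥ (O.1# , n) (ℚ.- (+ ⌊log p ⌋ m / 1))
    Ord≥-reciprocal = F.Ord-reciprocal

    Ord≥-difference : ∀ a b → π O.∣ a O.- b → Ord≥ (𝒪→K a K.- 𝒪→K b) (+ 1 / e)
    Ord≥-difference a b (q , qπ≈) = F.Ord-difference a b (q , qπ≈)

    Ord≡-inverse : ∀ {z w ν} → Inverse z w → Ord≡ z ν → Ord≥ w (ℚ.- ν)
    Ord≡-inverse {z} {w} zw≈1 (m , n , a , (b , ba≈1) , refl , eq) = F.Ord-inverse m n {z} {w} {a} {b} zw≈1 ba≈1 eq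

  Ord≡⇒Ord≥ : ∀ {z ν} → Ord≡ z ν → Ord≥ z ν
  Ord≡⇒Ord≥ (m , n , a , _ , ν≡ , eq) = m , n , a , ≤-reflexive ν≡ , eq

-- Error estimates for the individual terms

n/1*1/e≡n/e : ∀ n e .{{_ : NonZero e}} → + n / 1 ℚ.* (+ 1 / e) ≡ + n / e
n/1*1/e≡n/e zero    e = trans (ℚProps.*-zeroˡ (+ 1 / e)) (sym (ℚProps.0/n≡0 e))
n/1*1/e≡n/e (suc n) e = begin
  + suc n / 1 ℚ.* x           ≡⟨ cong (ℚ._* x) (suc/1 n) ⟩
  (1ℚ ℚ.+ + n / 1) ℚ.* x      ≡⟨ ℚProps.*-distribʳ-+ x 1ℚ (+ n / 1) ⟩
  1ℚ ℚ.* x ℚ.+ + n / 1 ℚ.* x  ≡⟨ cong₂ ℚ._+_ (ℚProps.*-identityˡ x) (n/1*1/e≡n/e n e) ⟩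
  + 1 / e ℚ.+ + n / e         ≡⟨ /-homo-+ (+ 1) (+ n) e ⟨
  + suc n / e                 ∎
  where
  open ≡.≡-Reasoning
  x = + 1 / e

-- Applied to the precision `N ≥ 1`: an error of order `N` leaves `t̃` with order at least `1/e`.
1/e≤n/1 : ∀ n e .{{_ : NonZero n}} .{{_ : NonZero e}} → + 1 / e ℚ.≤ + n / 1
1/e≤n/1 n e = ≤-trans (/-monoˡ-≤ {+ 1} {+ n ℤ.* + e} e
    (subst (+ 1 ℤ.≤_) (ℤProps.pos-* n e) (ℤ.+≤+ (ℕProps.*-mono-≤ (ℕ.>-nonZero⁻¹ n) (ℕ.>-nonZero⁻¹ e)))))
  (≤-reflexive ([i*n]/n≡i/1 (+ n) e))

0<1/e : ∀ e .{{_ : NonZero e}} → 0ℚ ℚ.< + 1 / e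
0<1/e e = ℚProps.positive⁻¹ (+ 1 / e) {{ℚProps.normalize-pos 1 e}}

-- The cases follow the clauses of `antiderivative`; `-[1+ suc j ]` is the exponent `-(j+2)`, so a
-- polar term occurs only if `k ≥ 2`.
data Exponent (k l : ℕ) : ℤ → Set where
  nonnegative : ∀ {j} → j ℕ.< l → Exponent k l (+ j)
  residual     : Exponent k l -[1+ 0 ]
  negative    : ∀ {j} → suc (suc j) ℕ.≤ k → Exponent k l -[1+ suc j ]

exponent : ∀ k l {n} → n ℕ.< k ℕ.+ l → Exponent k l (n ⊖ k)
exponent k l {n} n<k+l with k ℕProps.≤? n
... | yes k≤n = subst (Exponent k l) (sym (ℤProps.⊖-≥ k≤n))
      (nonnegative (ℕProps.+-cancelˡ-< k _ _ (subst (ℕ._< k ℕ.+ l) (sym (ℕProps.m+[n∸m]≡n k≤n)) n<k+l)))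
... | no  k≰n = subst (Exponent k l) (sym (ℤProps.⊖-< (ℕProps.≰⇒> k≰n)))
      (below (ℕProps.m<n⇒0<n∸m (ℕProps.≰⇒> k≰n)) (ℕProps.m∸n≤m k n))
  where
  below : ∀ {m} → 0 ℕ.< m → m ℕ.≤ k → Exponent k l (ℤ.- (+ m))
  below {suc zero}    _ _   = residual
  below {suc (suc m)} _ m≤k = negative m≤k

module Estimates (p e : ℕ) .{{e≢0 : NonZero e}} (p-prime : Prime p) where
  open Field p e
  open Bounds p e
  open PadicField p e p-prime
  open Filtered K-isFiltration
  private
    module K = Ring K
    module O = Ring 𝒪

  module Point (N : ℕ) .{{N≢0 : NonZero N}} {t t̃ t⁻¹ t̃⁻¹ : ⟨ K ⟩}
    (ord-t : Ord≥ t (+ 1 / e)) (t-error : Ord≥ (t̃ K.- t) (fromℕ N)) where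

    ord-t̃ : Ord≥ t̃ (+ 1 / e)
    ord-t̃ = Ord-perturb {t} {t̃} ord-t (Ord-weaken {t̃ K.- t} (1/e≤n/1 N e) t-error)

    -- The power `tⁿ⁺¹` has order at least `(n+1)/e`, one step `1/e` more than `term n` counts: this
    -- is the summand `1/e` of `ν₁`.
    ord-antiderivative : ∀ (a : ⟨ ℤₚ p ⟩) {l min₁ n i} → (∀ i → l ℕ.≤ i → min₁ ℚ.≤ term i) → l ℕ.≤ n →
      i ≡ + n → Ord≥ (antiderivative (ℤₚ→K a) t t⁻¹ i) (ν₁ min₁)
    ord-antiderivative a {l} {min₁} {n} min₁≤ l≤n refl = Ord-weaken {ℤₚ→K a K.* c K.* t K.^ suc n} bound
      (Ord-term {ℤₚ→K a} {c} {t} (Ord≥-integral (ℤₚ→𝒪 a)) (Ord≥-reciprocal n (suc n) ℕProps.≤-refl) ord-t n)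
      where
      L = fromℕ (⌊log p ⌋ (suc n))
      c = O.1# , n
      bound : ν₁ min₁ ℚ.≤ ℚ.- L ℚ.+ + suc n / 1 ℚ.* (+ 1 / e)
      bound = ≤-trans (ℚProps.+-monoʳ-≤ (+ 1 / e) (min₁≤ n l≤n)) (≤-reflexive (sym (begin
        ℚ.- L ℚ.+ + suc n / 1 ℚ.* (+ 1 / e)           ≡⟨ cong (ℚ.- L ℚ.+_) (n/1*1/e≡n/e (suc n) e) ⟩
        ℚ.- L ℚ.+ + suc n / e                         ≡⟨ cong (ℚ.- L ℚ.+_) (/-homo-+ (+ 1) (+ n) e) ⟩
        ℚ.- L ℚ.+ (+ 1 / e ℚ.+ + n / e)               ≡⟨ solve 3 (λ L x y → :- L :+ (x :+ y) := x :+ (y :- L)) refl L (+ 1 / e) (+ n / e) ⟩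
        + 1 / e ℚ.+ term n                            ∎)))
        where
        open ≡.≡-Reasoning
        open +-*-Solver

    -- For nonnegative exponents the displacement of `tⁿ⁺¹` has order only `N + n/e`, one factor `t`
    -- having been replaced by the error. Hence `ν₂`, unlike `ν₁`, has no summand `1/e`.
    antiderivative-error : ∀ (a ã : ⟨ ℤₚ p ⟩) {k l min₂ o M ν i} →
      Ord≥ (ℤₚ→K ã K.- ℤₚ→K a) (fromℕ N) → (∀ i → i ℕ.< l → min₂ ℚ.≤ term i) →
      (2 ℕ.≤ k → Inverse t t⁻¹ × Inverse t̃ t̃⁻¹ × ¬ Ord≥ t̃ (fromℕ N) × Ord≡ t o) → o ℚ.≤ M →
      ν ℚ.≤ ν₂ N min₂ →
      (∀ {k′} → k ≡ suc (suc k′) → ν ℚ.≤ fromℕ N ℚ.- fromℕ k ℚ.* M ℚ.- fromℕ (⌊log p ⌋ (suc k′))) →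
      Exponent k l i →
      Ord≥ (antiderivative (ℤₚ→K ã) t̃ t̃⁻¹ i K.- antiderivative (ℤₚ→K a) t t⁻¹ i) ν
    antiderivative-error a ã {min₂ = min₂} a-error min₂≤ inverses o≤M ν≤ν₂ ν≤ν₃ (nonnegative {n} n<l) =
      Ord-weaken {ℤₚ→K ã K.* c K.* t̃ K.^ suc n K.- ℤₚ→K a K.* c K.* t K.^ suc n} (≤-trans ν≤ν₂ bound)
        (Ord-term-difference {ℤₚ→K a} {ℤₚ→K ã} {c} {t} {t̃} (Ord≥-integral (ℤₚ→𝒪 a)) a-error (Ord≥-reciprocal n (suc n) ℕProps.≤-refl)
          ord-t ord-t̃ t-error (x≤x+d (fromℕ N) (0≤n/d 1 e)) n)
      where
      L = fromℕ (⌊log p ⌋ (suc n))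
      c = O.1# , n
      bound : ν₂ N min₂ ℚ.≤ ℚ.- L ℚ.+ (fromℕ N ℚ.+ + n / 1 ℚ.* (+ 1 / e))
      bound = ≤-trans (ℚProps.+-monoʳ-≤ (fromℕ N) (min₂≤ n n<l)) (≤-reflexive (sym (begin
        ℚ.- L ℚ.+ (fromℕ N ℚ.+ + n / 1 ℚ.* (+ 1 / e))  ≡⟨ cong (λ x → ℚ.- L ℚ.+ (fromℕ N ℚ.+ x)) (n/1*1/e≡n/e n e) ⟩
        ℚ.- L ℚ.+ (fromℕ N ℚ.+ + n / e)                ≡⟨ solve 3 (λ L x y → :- L :+ (x :+ y) := x :+ (y :- L)) refl L (fromℕ N) (+ n / e) ⟩
        fromℕ N ℚ.+ term n                             ∎)))
        where
        open ≡.≡-Reasoning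
        open +-*-Solver
    antiderivative-error a ã a-error min₂≤ inverses o≤M ν≤ν₂ ν≤ν₃ residual =
      Ord-subtract {K.0#} {K.0#} Ord-0# Ord-0#
    -- `k` is rebound here to the pole order minus 2; the denominator satisfies `n+1 ≤ suc k`, which
    -- gives the logarithm of the pole order minus 1.
    antiderivative-error a ã {k = suc (suc k)} {o = o} a-error min₂≤ inverses o≤M ν≤ν₂ ν≤ν₃ (negative {n} n+2≤k@(s≤s n+1≤k)) =
      let tt⁻¹ , t̃t̃⁻¹ , t̃≢0 , ord≡-t = inverses (s≤s (s≤s z≤n)) in
      Ord-weaken {K.- (ℤₚ→K ã K.* c K.* t̃⁻¹ K.^ suc n) K.- K.- (ℤₚ→K a K.* c K.* t⁻¹ K.^ suc n)} (ν≤ν₃ refl)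
        (Ord-negative-term-difference {ℤₚ→K a} {ℤₚ→K ã} {c} {t} {t⁻¹} {t̃} {t̃⁻¹} (Ord≥-integral (ℤₚ→𝒪 a)) a-error (Ord≥-reciprocal n (suc k) n+1≤k)
          tt⁻¹ t̃t̃⁻¹ (0<1/e e) ord-t (Ord≡⇒Ord≥ ord≡-t) (Ord≡-inverse tt⁻¹ ord≡-t)
          t-error t̃≢0 o≤M n+2≤k)
      where c = O.1# , n

x⊓⁺y≤x : ∀ x y → x ⊓⁺ y ℚ.≤ x
x⊓⁺y≤x x [ y ] = ℚProps.p⊓q≤p x y
x⊓⁺y≤x x ⊤⁺    = ℚProps.≤-refl

-- From single terms to the limit of partial sums

module TinyIntegral (p e : ℕ) .{{e≢0 : NonZero e}} (p-prime : Prime p) where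
  open Field p e
  open Bounds p e
  open PadicField p e p-prime
  open Filtered K-isFiltration
  open Estimates p e p-prime
  private
    module K = Ring K

  -- The exact integral is given only as a limit, so an exact partial sum within `ν` of `I`
  -- mediates. A sum of `k + l` terms covers exactly the exponents from `-k` to `l-1`.
  integral-error : ∀ (N k l : ℕ) .{{_ : NonZero N}} (a ã : ℤ → ⟨ ℤₚ p ⟩) {tP t̃P tP⁻¹ t̃P⁻¹ tQ t̃Q tQ⁻¹ t̃Q⁻¹ oP oQ min₁ min₂ I} →
    Ord≥ tP (+ 1 / e) → Ord≥ (t̃P K.- tP) (fromℕ N) →
    Ord≥ tQ (+ 1 / e) → Ord≥ (t̃Q K.- tQ) (fromℕ N) →
    (2 ℕ.≤ k → Inverse tP tP⁻¹ × Inverse t̃P t̃P⁻¹ × ¬ Ord≥ t̃P (fromℕ N) × Ord≡ tP oP) →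
    (2 ℕ.≤ k → Inverse tQ tQ⁻¹ × Inverse t̃Q t̃Q⁻¹ × ¬ Ord≥ t̃Q (fromℕ N) × Ord≡ tQ oQ) →
    (∀ n → n ℕ.< k ℕ.+ l → CorrectTo (fromℕ N) (ℤₚ→K (ã (n ⊖ k))) (ℤₚ→K (a (n ⊖ k)))) →
    IsLimit (λ m → integralUpTo k m (λ i → ℤₚ→K (a i)) tP tP⁻¹ tQ tQ⁻¹) I →
    (∀ i → l ℕ.≤ i → min₁ ℚ.≤ term i) → (∀ i → i ℕ.< l → min₂ ℚ.≤ term i) →
    CorrectTo ((ν₁ min₁ ⊓ ν₂ N min₂) ⊓⁺ ν₃ N k oP oQ)
      (integralUpTo k (k ℕ.+ l) (λ i → ℤₚ→K (ã i)) t̃P t̃P⁻¹ t̃Q t̃Q⁻¹) I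
  integral-error N k l a ã {tP} {t̃P} {tP⁻¹} {t̃P⁻¹} {tQ} {t̃Q} {tQ⁻¹} {t̃Q⁻¹} {oP} {oQ} {min₁} {min₂} {I}
    oP≥ errorP oQ≥ errorQ inversesP inversesQ a-error limit min₁≤ min₂≤ =
    let M , ν≤M·1 = archimedean {1ℚ} (ℚ.*<* (ℤ.+<+ (s≤s z≤n))) ν
        n₀ , converges = limit M
        m = n₀ ℕ.⊔ (k ℕ.+ l)
    in Ord-triangle {integralUpTo k (k ℕ.+ l) (λ i → ℤₚ→K (ã i)) t̃P t̃P⁻¹ t̃Q t̃Q⁻¹} {I}
         (integralUpTo k m (λ i → ℤₚ→K (a i)) tP tP⁻¹ tQ tQ⁻¹)
         (Ord-sum-difference f̃ f (ℕProps.m≤n⊔m n₀ (k ℕ.+ l)) head tail)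
         (Ord-weaken {integralUpTo k m (λ i → ℤₚ→K (a i)) tP tP⁻¹ tQ tQ⁻¹ K.- I}
           (≤-trans ν≤M·1 (≤-reflexive (ℚProps.*-identityʳ (+ M / 1))))
           (converges m (ℕProps.m≤m⊔n n₀ (k ℕ.+ l))))
    where
    module P = Point N {tP} {t̃P} {tP⁻¹} {t̃P⁻¹} oP≥ errorP
    module Q = Point N {tQ} {t̃Q} {tQ⁻¹} {t̃Q⁻¹} oQ≥ errorQ
    ν = (ν₁ min₁ ⊓ ν₂ N min₂) ⊓⁺ ν₃ N k oP oQ
    ν≤ν₁ : ν ℚ.≤ ν₁ min₁
    ν≤ν₁ = ≤-trans (x⊓⁺y≤x _ (ν₃ N k oP oQ)) (ℚProps.p⊓q≤p (ν₁ min₁) (ν₂ N min₂))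
    ν≤ν₂ : ν ℚ.≤ ν₂ N min₂
    ν≤ν₂ = ≤-trans (x⊓⁺y≤x _ (ν₃ N k oP oQ)) (ℚProps.p⊓q≤q (ν₁ min₁) (ν₂ N min₂))
    -- Only for `k ≥ 2` does `ν₃` compute to a finite bound; for `k = 1` it is `⊤⁺`.
    ν≤ν₃ : ∀ {k′} → k ≡ suc (suc k′) → ν ℚ.≤ fromℕ N ℚ.- fromℕ k ℚ.* (oP ⊔ oQ) ℚ.- fromℕ (⌊log p ⌋ (suc k′))
    ν≤ν₃ refl = ℚProps.p⊓q≤q (ν₁ min₁ ⊓ ν₂ N min₂) _
    termP termQ term̃P term̃Q f f̃ : ℕ → ⟨ K ⟩
    termP n = antiderivative (ℤₚ→K (a (n ⊖ k))) tP tP⁻¹ (n ⊖ k)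
    termQ n = antiderivative (ℤₚ→K (a (n ⊖ k))) tQ tQ⁻¹ (n ⊖ k)
    term̃P n = antiderivative (ℤₚ→K (ã (n ⊖ k))) t̃P t̃P⁻¹ (n ⊖ k)
    term̃Q n = antiderivative (ℤₚ→K (ã (n ⊖ k))) t̃Q t̃Q⁻¹ (n ⊖ k)
    f n = termQ n K.- termP n
    f̃ n = term̃Q n K.- term̃P n
    head : ∀ n → n ℕ.< k ℕ.+ l → Ord≥ (f̃ n K.- f n) ν
    head n n<k+l = Ord-[-] {term̃Q n} {term̃P n} {termQ n} {termP n}
      (Q.antiderivative-error (a (n ⊖ k)) (ã (n ⊖ k)) {o = oQ} (a-error n n<k+l) min₂≤ inversesQ
        (ℚProps.p≤q⊔p oP oQ) ν≤ν₂ ν≤ν₃ (exponent k l n<k+l))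
      (P.antiderivative-error (a (n ⊖ k)) (ã (n ⊖ k)) {o = oP} (a-error n n<k+l) min₂≤ inversesP
        (ℚProps.p≤p⊔q oP oQ) ν≤ν₂ ν≤ν₃ (exponent k l n<k+l))
    tail : ∀ n → k ℕ.+ l ℕ.≤ n → Ord≥ (f n) ν
    tail n k+l≤n = Ord-weaken {f n} ν≤ν₁ (Ord-subtract {termQ n} {termP n} ordQ ordP)
      where
      n⊖k : n ⊖ k ≡ + (n ℕ.∸ k)
      n⊖k = ℤProps.⊖-≥ (ℕProps.≤-trans (ℕProps.m≤m+n k l) k+l≤n)
      l≤n∸k : l ℕ.≤ n ℕ.∸ k
      l≤n∸k = ℕProps.≤-trans (ℕProps.≤-reflexive (sym (ℕProps.m+n∸m≡n k l))) (ℕProps.∸-monoˡ-≤ k k+l≤n)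
      ordQ : Ord≥ (termQ n) (ν₁ min₁)
      ordQ = Q.ord-antiderivative (a (n ⊖ k)) min₁≤ l≤n∸k n⊖k
      ordP : Ord≥ (termP n) (ν₁ min₁)
      ordP = P.ord-antiderivative (a (n ⊖ k)) min₁≤ l≤n∸k n⊖k

-- Residue disks and the order of the local coordinate

module Disks (X : Curve) (p : ℕ) (p-prime : Prime p) (G : GoodReduction X p) (e : ℕ) .{{e≢0 : NonZero e}} where
  open Geometry X p G e
  open PadicField p e p-prime
  open Filtered K-isFiltration
  private
    module K = Ring K
    module O = Ring 𝒪

  -- The form of `SameDisk` in the filtration of `K`: a multiple of `π` has order at least `1/e`.
  Near : ∀ {χ} → PointOver χ → PointOver χ → Set
  Near P Q = ∀ g → Ord≥ (inK P g K.- inK Q g) (+ 1 / e)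

  sameDisk⇒near : ∀ {χ} {P Q : PointOver χ} → SameDisk P Q → Near P Q
  sameDisk⇒near {P = P} {Q} same g = Ord≥-difference (at P g) (at Q g) (same g)

  centre⇒near : ∀ {χ} {P P′ : PointOver χ} → IsCentre P P′ → Near P P′
  centre⇒near {P = P} {P′} (inj₁ (_ , same))  = sameDisk⇒near {P = P} {P′} same
  centre⇒near {P = P} {P′} (inj₂ (_ , equal)) g = Ord≥-difference (at P g) (at P′ g)
    (O.0# , O.trans (O.zeroˡ π) (O.sym (O.trans (O.+-congʳ (O.sym (equal g))) (O.-‿inverseʳ (at P′ g)))))

  near-trans : ∀ {χ} {P Q R : PointOver χ} → Near Q P → Near P R → Near Q R
  near-trans {P = P} {Q} {R} QP PR g = Ord-triangle {inK Q g} {inK R g} (inK P g) (QP g) (PR g)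

  near-sym : ∀ {χ} {P Q : PointOver χ} → Near P Q → Near Q P
  near-sym {P = P} {Q} PQ g = Ord-swap {inK P g} {inK Q g} (PQ g)

  ord-localCoordinate : ∀ {χ} {P P′ : PointOver χ} → Near P P′ → ∀ h →
    Ord≥ (localCoordinate K χ (inK P′) h (inK P)) (+ 1 / e)
  ord-localCoordinate {finite}           near base      = near base
  -- Here `t` is `1/x` itself, not a difference of values, so its order comes from `1/x` reducing to
  -- 0 on an infinite disk.
  ord-localCoordinate {infinite} {P}     near base      = Ord≥-difference (at P base) O.0#
    (let q , qπ≈ = atInfinity P refl in
     q , O.trans qπ≈ (O.sym (O.trans (O.+-congˡ (O.trans (O.sym (O.+-identityˡ (O.- O.0#))) (O.-‿inverseʳ O.0#))) (O.+-identityʳ (at P base)))))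
  ord-localCoordinate {finite}           near (fibre j) = near (fibre j)
  ord-localCoordinate {infinite}         near (fibre j) = near (fibre j)

  -- The centre is approximate too, but by the ultrametric inequality its error does not lower the
  -- precision; for `t = 1/x` the centre value 0 is exact.
  localCoordinate-error : ∀ {χ ν P̃ P̃′} {P P′ : PointOver χ} → AccurateTo ν P̃ P → AccurateTo ν P̃′ P′ → ∀ h →
    Ord≥ (localCoordinate K χ P̃′ h P̃ K.- localCoordinate K χ (inK P′) h (inK P)) ν
  localCoordinate-error {finite} {P̃ = P̃} {P̃′} {P} {P′} acc acc′ base =
    Ord-[-] {P̃ base} {P̃′ base} {inK P base} {inK P′ base} (acc base) (acc′ base)
  localCoordinate-error {infinite} {P̃ = P̃} {P̃′} {P} {P′} acc acc′ base =
    Ord-[-] {P̃ base} {K.0#} {inK P base} {K.0#} (acc base) (Ord-subtract {K.0#} {K.0#} Ord-0# Ord-0#)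
  localCoordinate-error {finite} {P̃ = P̃} {P̃′} {P} {P′} acc acc′ (fibre j) =
    Ord-[-] {P̃ (fibre j)} {P̃′ (fibre j)} {inK P (fibre j)} {inK P′ (fibre j)} (acc (fibre j)) (acc′ (fibre j))
  localCoordinate-error {infinite} {P̃ = P̃} {P̃′} {P} {P′} acc acc′ (fibre j) =
    Ord-[-] {P̃ (fibre j)} {P̃′ (fibre j)} {inK P (fibre j)} {inK P′ (fibre j)} (acc (fibre j)) (acc′ (fibre j))

open import Data.Nat.Base using (_≤_; _<_; _+_)

proposition4p1 :
  ∀ (X : Curve) (p : ℕ) → Prime p → (G : GoodReduction X p) →
  ∀ (e N : ℕ) .{{_ : NonZero e}} .{{_ : NonZero N}} →
  let open Geometry X p G e
      open Bounds p e in
  ∀ {χ} (P Q : PointOver χ) → SameDisk P Q →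
  ∀ (P′ : PointOver χ) → IsCentre P P′ → (t : LocalCoordinate P′) →
  ∀ (ω : Differential) → SecondKind ω →
  ∀ (k : ℕ) .{{_ : NonZero k}} (a : ℤ → ⟨ ℤₚ p ⟩) →
  HasExpansion K ℤₚ→K χ (LocalCoordinate.expansion t) ω k (λ i → ℤₚ→K (a i)) →
  ∀ (P̃ Q̃ P̃′ : Values K) →
  AccurateTo (fromℕ N) P̃ P → AccurateTo (fromℕ N) Q̃ Q → AccurateTo (fromℕ N) P̃′ P′ →
  let tP = localCoordinate K χ (inK P′) (LocalCoordinate.h t) (inK P)
      tQ = localCoordinate K χ (inK P′) (LocalCoordinate.h t) (inK Q)
      t̃P = localCoordinate K χ P̃′ (LocalCoordinate.h t) P̃
      t̃Q = localCoordinate K χ P̃′ (LocalCoordinate.h t) Q̃ in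
  ∀ (tP⁻¹ tQ⁻¹ t̃P⁻¹ t̃Q⁻¹ : ⟨ K ⟩) (ordP ordQ : ℚ) →
  (2 ≤ k → Inverse tP tP⁻¹ × Inverse tQ tQ⁻¹ × Inverse t̃P t̃P⁻¹ × Inverse t̃Q t̃Q⁻¹
         × ¬ Ord≥ t̃P (fromℕ N) × ¬ Ord≥ t̃Q (fromℕ N)
         × Ord≡ tP ordP × Ord≡ tQ ordQ) →
  ∀ (l : ℕ) .{{_ : NonZero l}} (ã : ℤ → ⟨ ℤₚ p ⟩) →
  (∀ n → n < k + l → CorrectTo (fromℕ N) (ℤₚ→K (ã (n ⊖ k))) (ℤₚ→K (a (n ⊖ k)))) →
  ∀ (I : ⟨ K ⟩) →
  IsLimit (λ m → integralUpTo k m (λ i → ℤₚ→K (a i)) tP tP⁻¹ tQ tQ⁻¹) I →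
  ∀ (min₁ min₂ : ℚ) → IsMinimum (l ≤_) term min₁ → IsMinimum (_< l) term min₂ →
  CorrectTo ((ν₁ min₁ ⊓ ν₂ N min₂) ⊓⁺ ν₃ N k ordP ordQ)
    (integralUpTo k (k + l) (λ i → ℤₚ→K (ã i)) t̃P t̃P⁻¹ t̃Q t̃Q⁻¹) I
proposition4p1 X p p-prime G e N {χ} P Q same P′ centre t _ _ k a _ P̃ Q̃ P̃′ accP accQ accP′
    tP⁻¹ tQ⁻¹ t̃P⁻¹ t̃Q⁻¹ ordP ordQ inverses l ã a-error I limit min₁ min₂ (_ , min₁≤) (_ , min₂≤) =
  TinyIntegral.integral-error p e p-prime N k l a ã {tP} {t̃P} {tP⁻¹} {t̃P⁻¹} {tQ} {t̃Q} {tQ⁻¹} {t̃Q⁻¹} {ordP} {ordQ} {min₁} {min₂} {I}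
    (ord-localCoordinate {P = P} {P′} nearP h) (localCoordinate-error {P̃ = P̃} {P̃′} {P} {P′} accP accP′ h)
    (ord-localCoordinate {P = Q} {P′} nearQ h) (localCoordinate-error {P̃ = Q̃} {P̃′} {Q} {P′} accQ accP′ h)
    (λ 2≤k → let iP , _ , iP̃ , _ , ≢P , _ , oP , _ = inverses 2≤k in iP , iP̃ , ≢P , oP)
    (λ 2≤k → let _ , iQ , _ , iQ̃ , _ , ≢Q , _ , oQ = inverses 2≤k in iQ , iQ̃ , ≢Q , oQ)
    a-error limit min₁≤ min₂≤
  where
  open Geometry X p G e
  open Disks X p p-prime G e
  open LocalCoordinate t using (h)
  tP = localCoordinate K χ (inK P′) h (inK P)
  tQ = localCoordinate K χ (inK P′) h (inK Q)
  t̃P = localCoordinate K χ P̃′ h P̃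
  t̃Q = localCoordinate K χ P̃′ h Q̃
  nearP : Near P P′
  nearP = centre⇒near {P = P} {P′} centre
  -- The centre is attached to `P`, so `Q` reaches it through `P`.
  nearQ : Near Q P′
  nearQ = near-trans {P = P} {Q} {P′} (near-sym {P = P} {Q} (sameDisk⇒near {P = P} {Q} same)) nearP
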